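{- Let $s>k\geqslant 5$ be positive integers with $s>101k^3$, and let $n$ be an integer satisfying $(s+1)k\leqslant n<(s+1)\left(k+\frac{1}{100k}\right)$. Then for every family $\mathcal{F}\subset\binom{[n]}{k}$ with $\nu(\mathcal{F})\leqslant s$ we have $|\mathcal{F}|\leqslant|\mathcal{A}|$, where $\mathcal{A}=\binom{[(s+1)k-1]}{k}$; that is, $|\mathcal{F}|\leqslant\binom{(s+1)k-1}{k}$.
   Context: $[m]=\{1,\ldots,m\}$. For a set $X$, $\binom{X}{k}$ denotes the set of all $k$-element subsets of $X$. A family is a collection of sets, and $\nu(\mathcal{F})$ denotes the matching number of $\mathcal{F}$, i.e. the maximum number of pairwise disjoint sets in $\mathcal{F}$. -}

module Defs where

open import Data.Empty using (⊥)
open import Data.Fin.Base using (toℕ)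
open import Data.Fin.Subset using (Subset; inside; outside; Empty; _⊆_; _∩_; ∣_∣)
open import Data.Fin.Subset.Properties using (_⊆?_; nonempty?)
open import Data.List.Base using (List; []; _∷_; _++_; map; filter; length)
open import Data.List.Extrema.Nat using (max)
open import Data.List.Membership.Propositional using (_∈_)
open import Data.List.Membership.Propositional.Properties using (∈-map⁻)
import Data.List.Relation.Binary.Subset.Propositional as List
import Data.List.Relation.Unary.All as All
open import Data.List.Relation.Unary.AllPairs using (allPairs?; []; _∷_)
open import Data.List.Relation.Unary.Unique.Propositional using (Unique)
open import Data.List.Relation.Unary.Unique.Propositional.Properties using (map⁺; ++⁺; filter⁺)
open import Data.Nat.Base using (ℕ; zero; suc)
open import Data.Nat.Properties using (_≟_; _<?_)
open import Data.Product.Base using (_×_; _,_)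
open import Data.Vec.Base using (_∷_; []; tabulate)
open import Data.Vec.Properties using (∷-injectiveʳ)
open import Relation.Binary.PropositionalEquality.Core using (_≡_; refl)
open import Relation.Nullary.Decidable using (Dec; does; ¬?; _×-dec_)

-- [n] is represented by Fin n, with i ∈ [n] corresponding to the element of
-- Fin n whose toℕ is i - 1.  A family of subsets of [n] is a duplicate-free
-- list, so that the length of the list is the cardinality of the family; the
-- order of the list carries no meaning.
record Family (n : ℕ) : Set where
  constructor family
  field
    members : List (Subset n)
    unique  : Unique members

open Family public

card : ∀ {n} → Family n → ℕ
card F = length (members F)

infix 4 _⊆ᶠ_

_⊆ᶠ_ : ∀ {n} → Family n → Family n → Set
F ⊆ᶠ G = members F List.⊆ members G

subsets : ∀ n → List (Subset n)
subsets zero    = [] ∷ []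
subsets (suc n) = map (outside ∷_) (subsets n) ++ map (inside ∷_) (subsets n)

subsets-unique : ∀ n → Unique (subsets n)
subsets-unique zero    = All.[] ∷ []
subsets-unique (suc n) =
  ++⁺ (map⁺ ∷-injectiveʳ (subsets-unique n))
      (map⁺ ∷-injectiveʳ (subsets-unique n))
      disjoint
  where
  disjoint : ∀ {p} → p ∈ map (outside ∷_) (subsets n) ×
                     p ∈ map (inside ∷_) (subsets n) → ⊥
  disjoint (p∈₁ , p∈₂) with ∈-map⁻ (outside ∷_) p∈₁ | ∈-map⁻ (inside ∷_) p∈₂
  ... | _ , _ , refl | _ , _ , ()

-- binom X k is the family of all k-element subsets of X.
binom : ∀ {n} → Subset n → ℕ → Family n
binom {n} X k = family (filter P? (subsets n)) (filter⁺ P? (subsets-unique n))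
  where
  P? : ∀ (p : Subset n) → Dec (p ⊆ X × ∣ p ∣ ≡ k)
  P? p = (p ⊆? X) ×-dec (∣ p ∣ ≟ k)

-- The subset {1, …, m} of [n]; it equals [m] when m ≤ n.
initial : ∀ n → ℕ → Subset n
initial n m = tabulate (λ i → does (toℕ i <? m))

Disjoint : ∀ {n} → Subset n → Subset n → Set
Disjoint p q = Empty (p ∩ q)

disjoint? : ∀ {n} (p q : Subset n) → Dec (Disjoint p q)
disjoint? p q = ¬? (nonempty? (p ∩ q))

sublists : ∀ {a} {A : Set a} → List A → List (List A)
sublists []       = [] ∷ []
sublists (x ∷ xs) = sublists xs ++ map (x ∷_) (sublists xs)

-- As the members of F are distinct, the sublists of members F list each
-- subfamily of F exactly once.  The empty subfamily is a matching, so the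
-- default value 0 of max never exceeds the maximum.
ν : ∀ {n} → Family n → ℕ
ν F = max 0 (map length (filter (allPairs? disjoint?) (sublists (members F))))

{-# OPTIONS --safe #-}
module Submission where

-- Let 𝒢 be the complement of F among the k-sets, write n = (s + 1) k + r, and
-- suppose that |F| exceeds the bound, so that |𝒢| < (r + 1) C(n − 1, k − 1).  Call
-- a vertex heavy if it lies on at least half of the possible sets of 𝒢; there are
-- fewer than 3 (r + 1) heavy vertices.  A greedy choice of disjoint members of F
-- covers all but at most r of them: if it got stuck, the heavy vertices would lie
-- on too few members of F for |F| to exceed the bound.  Discard r vertices,
-- including the remaining heavy ones, and divide the rest into blocks of size k.
--
-- If the 𝒢-degrees of the vertices of a block e ∈ 𝒢 add up to less than
-- C(n − 1, k − 1), up to lower order terms, then averaging over the systems of k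
-- disjoint transversals of k − 1 further blocks shows that e and these blocks can
-- be repartitioned into members of F.  Otherwise some vertex x of e can be traded
-- for a vertex of smaller degree in a block of small total degree, which together
-- with x then plays the role of e.  Either move decreases the sum of 1 + (total
-- degree) over the blocks in 𝒢, so in the end all blocks belong to F, and there
-- are s + 1 disjoint members of F.

open import Defs
open import Data.Bool.Base using (true; false; if_then_else_)
import Data.Bool.Properties as Bool
open import Data.Fin.Base using (Fin; zero; suc)
import Data.Fin.Properties as Fin
open import Data.Fin.Subset using (Subset; inside; outside; ⊤; ⊥; ∣_∣)
import Data.Fin.Subset as Subset
open import Data.Fin.Subset.Properties as Subset using (_⊆?_; ∉⊥; ∣⊥∣≡0; ⊆-antisym; x∈p∩q⁺; x∈p∩q⁻; drop-∷-⊆; out⊆; in⊆in)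
open import Data.Integer.Base using (+_)
import Data.Integer.Base as ℤ
open import Data.Integer.Properties as ℤ using (pos-*; drop‿+<+)
open import Data.List.Base using (List; []; _∷_; _++_; map; filter; length; concat; zipWith; take; drop; allFin)
open import Data.List.Extrema.Nat using (v≤max⁺)
open import Data.List.Membership.Propositional using (_∈_; _∉_)
open import Data.List.Membership.Propositional.Properties using (∈-map⁺; ∈-filter⁺; ∈-filter⁻; ∈-++⁺ˡ; ∈-++⁺ʳ; ∈-allFin; ∈-concat⁺′)
open import Data.List.Properties using (map-++; length-++; length-map; ++-assoc; ++-identityʳ; concat-++; filter-++; filter-none; filter-some; take++drop≡id; length-take; length-drop; length-tabulate)
open import Data.List.Relation.Binary.Permutation.Propositional using (_↭_; refl; prep; swap; trans; ↭-refl; ↭-sym; ↭-trans; ↭-reflexive; ↭⇒↭ₛ)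
open import Data.List.Relation.Binary.Permutation.Propositional.Properties using (shift; shifts; ++⁺; ++⁺ˡ; ++⁺ʳ; ++-comm; ↭-length; map⁺; filter-↭; All-resp-↭; ∈-resp-↭; ∷↭∷ʳ)
import Data.List.Relation.Binary.Permutation.Setoid.Properties as Permutation
open import Data.List.Relation.Binary.Pointwise.Base using (Pointwise; []; _∷_)
open import Data.List.Relation.Unary.All as All using (All; []; _∷_)
import Data.List.Relation.Unary.All.Properties as All
open import Data.List.Relation.Unary.Any as Any using (Any; here; there; any?)
open import Data.List.Relation.Unary.AllPairs using (AllPairs; []; _∷_; allPairs?)
open import Data.List.Relation.Unary.Unique.Propositional using (Unique)
import Data.List.Relation.Unary.Unique.Propositional.Properties as Unique
open import Data.Nat.Base using (ℕ; zero; suc; NonZero; >-nonZero; _+_; _*_; _∸_; _^_; _≤_; _<_; _>_; _≥_; z≤n; s≤s)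
open import Data.Nat.Combinatorics using (_C_; nCk+nC[k+1]≡[n+1]C[k+1])
open import Data.Nat.ListAction using (sum)
open import Data.Nat.ListAction.Properties using (sum-++; sum-↭)
open import Data.Nat.Properties
open import Data.Nat.Tactic.RingSolver using (solve-∀)
open import Data.Product.Base using (∃; ∃₂; ∃-syntax; _×_; _,_; proj₁; proj₂)
open import Data.Rational.Unnormalised.Base as ℚ using (_/_)
open import Data.Rational.Unnormalised.Properties using (drop-*<*)
open import Data.Sum.Base using (_⊎_; inj₁; inj₂)
open import Data.Vec.Base using (_[_]≔_; []; _∷_; here; there)
open import Data.Vec.Properties using ([]≔-idempotent; []≔-commutes; []≔-updates; []≔-minimal; ≡-dec)
open import Function.Base using (_∘_; id)
open import Relation.Binary.PropositionalEquality using (_≡_; _≢_; refl; sym; cong; cong₂; subst; subst₂; module ≡-Reasoning)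
import Relation.Binary.PropositionalEquality as ≡
open import Relation.Nullary.Decidable using (Dec; yes; no; ¬?; does; _×-dec_; decidable-stable)
open import Relation.Nullary.Negation using (¬_; contradiction)

private
  variable
    A B : Set
    n : ℕ

-- Sums over lists and averaging.

∑ : (A → ℕ) → List A → ℕ
∑ f xs = sum (map f xs)

∑-++ : ∀ (f : A → ℕ) xs ys → ∑ f (xs ++ ys) ≡ ∑ f xs + ∑ f ys
∑-++ f xs ys = ≡.trans (cong sum (map-++ f xs ys)) (sum-++ (map f xs) (map f ys))

∑-↭ : ∀ (f : A → ℕ) {xs ys} → xs ↭ ys → ∑ f xs ≡ ∑ f ys
∑-↭ f p = sum-↭ (map⁺ f p)

∑-mono-All : ∀ {f g : A → ℕ} {xs} → All (λ x → f x ≤ g x) xs → ∑ f xs ≤ ∑ g xs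
∑-mono-All []       = z≤n
∑-mono-All (p ∷ ps) = +-mono-≤ p (∑-mono-All ps)

∑-mono : ∀ {f g : A → ℕ} → (∀ x → f x ≤ g x) → ∀ xs → ∑ f xs ≤ ∑ g xs
∑-mono f≤g xs = ∑-mono-All (All.universal f≤g xs)

∑-cong : ∀ {f g : A → ℕ} → (∀ x → f x ≡ g x) → ∀ xs → ∑ f xs ≡ ∑ g xs
∑-cong f≡g []       = refl
∑-cong f≡g (x ∷ xs) = cong₂ _+_ (f≡g x) (∑-cong f≡g xs)

∑-+ : ∀ (f g : A → ℕ) xs → ∑ (λ x → f x + g x) xs ≡ ∑ f xs + ∑ g xs
∑-+ f g []       = refl
∑-+ f g (x ∷ xs) rewrite ∑-+ f g xs = interchange (f x) (g x) (∑ f xs) (∑ g xs)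
  where
  interchange : ∀ a b c d → a + b + (c + d) ≡ a + c + (b + d)
  interchange = solve-∀

∑-* : ∀ c (f : A → ℕ) xs → ∑ (λ x → c * f x) xs ≡ c * ∑ f xs
∑-* c f []       = sym (*-zeroʳ c)
∑-* c f (x ∷ xs) rewrite ∑-* c f xs = sym (*-distribˡ-+ c (f x) (∑ f xs))

∑-const : ∀ c (xs : List A) → ∑ (λ _ → c) xs ≡ length xs * c
∑-const c []       = refl
∑-const c (x ∷ xs) = cong (_+_ c) (∑-const c xs)

∑-≤-const : ∀ {f : A → ℕ} {c xs} → All (λ x → f x ≤ c) xs → ∑ f xs ≤ length xs * c
∑-≤-const {c = c} {xs} ps = ≤-trans (∑-mono-All ps) (≤-reflexive (∑-const c xs))

∑-concat : ∀ (f : A → ℕ) xss → ∑ f (concat xss) ≡ ∑ (∑ f) xss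
∑-concat f []         = refl
∑-concat f (xs ∷ xss) = ≡.trans (∑-++ f xs (concat xss)) (cong (_+_ (∑ f xs)) (∑-concat f xss))

concat-↭ : ∀ {xss yss : List (List A)} → xss ↭ yss → concat xss ↭ concat yss
concat-↭ refl         = refl
concat-↭ (prep xs p)  = ++⁺ˡ xs (concat-↭ p)
concat-↭ (swap xs ys p) = ↭-trans (shifts xs ys) (++⁺ˡ ys (++⁺ˡ xs (concat-↭ p)))
concat-↭ (trans p q)  = ↭-trans (concat-↭ p) (concat-↭ q)

Any⇒↭ : ∀ {P : A → Set} {xs} → Any P xs → ∃₂ λ x ys → xs ↭ x ∷ ys × P x
Any⇒↭ (here {x} {xs} px) = x , xs , ↭-refl , px
Any⇒↭ (there {x} p) with y , ys , q , py ← Any⇒↭ p = y , x ∷ ys , ↭-trans (prep x q) (swap x y refl) , py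

-- If every entry failed, adding the inequalities `∑ f xs + 1 ≤ l * f x` over all entries would give
-- `l + l * ∑ f xs ≤ l * ∑ f xs`. The average is multiplied out to avoid division, and the chosen
-- entry comes with a permutation that brings it to the front.
∃-≤-average : ∀ (f : A → ℕ) xs → 0 < length xs →
              ∃₂ λ x ys → xs ↭ x ∷ ys × length xs * f x ≤ ∑ f xs
∃-≤-average f xs 0<l with any? (λ x → length xs * f x ≤? ∑ f xs) xs
... | yes p = Any⇒↭ p
... | no ¬p = contradiction bound (<⇒≱ (m<n+m _ 0<l))
  where
  l = length xs
  bound : l + l * ∑ f xs ≤ l * ∑ f xs
  bound = begin
    l + l * ∑ f xs
      ≡⟨ cong (_+ l * ∑ f xs) (≡.trans (sym (*-identityʳ l)) (sym (∑-const 1 xs))) ⟩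
    ∑ (λ _ → 1) xs + l * ∑ f xs   ≡⟨ +-comm (∑ (λ _ → 1) xs) _ ⟩
    l * ∑ f xs + ∑ (λ _ → 1) xs   ≡⟨ cong (_+ ∑ (λ _ → 1) xs) (sym (∑-const (∑ f xs) xs)) ⟩
    ∑ (λ _ → ∑ f xs) xs + ∑ (λ _ → 1) xs ≡⟨ ∑-+ (λ _ → ∑ f xs) (λ _ → 1) xs ⟨
    ∑ (λ _ → ∑ f xs + 1) xs
      ≤⟨ ∑-mono-All (All.map (λ q → ≤-trans (≤-reflexive (+-comm _ 1)) (≰⇒> q)) (All.¬Any⇒All¬ xs ¬p)) ⟩
    ∑ (λ x → l * f x) xs          ≡⟨ ∑-* l f xs ⟩
    l * ∑ f xs                    ∎
    where open ≤-Reasoning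

∃-≥-average : ∀ (f : A → ℕ) xs → 0 < length xs →
              ∃₂ λ x ys → xs ↭ x ∷ ys × ∑ f xs ≤ length xs * f x
∃-≥-average f xs 0<l with any? (λ x → ∑ f xs ≤? length xs * f x) xs
... | yes p = Any⇒↭ p
... | no ¬p = contradiction bound (<⇒≱ (m<n+m _ 0<l))
  where
  l = length xs
  bound : l + l * ∑ f xs ≤ l * ∑ f xs
  bound = begin
    l + l * ∑ f xs
      ≡⟨ cong₂ _+_ (≡.trans (sym (*-identityʳ l)) (sym (∑-const 1 xs))) (sym (∑-* l f xs)) ⟩
    ∑ (λ _ → 1) xs + ∑ (λ x → l * f x) xs ≡⟨ ∑-+ (λ _ → 1) (λ x → l * f x) xs ⟨
    ∑ (λ x → suc (l * f x)) xs    ≤⟨ ∑-≤-const (All.map ≰⇒> (All.¬Any⇒All¬ xs ¬p)) ⟩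
    l * ∑ f xs                    ∎
    where open ≤-Reasoning

-- Binomial coefficients

pascal : ∀ n k → suc n C suc k ≡ n C k + n C suc k
pascal n k = sym (nCk+nC[k+1]≡[n+1]C[k+1] n k)

-- This is (k + 1) C(n, k + 1) = (n - k) C(n, k) with the subtraction moved to the left, so that it
-- holds in ℕ for n < k as well.
absorption : ∀ n k → suc k * (n C suc k) + k * (n C k) ≡ n * (n C k)
absorption zero    zero    = refl
absorption zero    (suc k) = ≡.trans (cong₂ _+_ (*-zeroʳ k) (*-zeroʳ k)) refl
absorption (suc n) zero    = begin
  1 * (suc n C 1) + 0       ≡⟨ cong (λ x → 1 * x + 0) (pascal n 0) ⟩
  1 * (n C 0 + n C 1) + 0
    ≡⟨ cong (λ x → 1 * (n C 0 + x) + 0) (≡.trans (sym (+-identityʳ _)) (≡.trans (sym (+-identityʳ _)) (absorption n 0))) ⟩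
  1 * (1 + n * 1) + 0       ≡⟨ arith n ⟩
  suc n * 1 ∎
  where
  open ≡-Reasoning
  arith : ∀ n → 1 * (1 + n * 1) + 0 ≡ suc n * 1
  arith = solve-∀
absorption (suc n) (suc k) = begin
  suc (suc k) * (suc n C suc (suc k)) + suc k * (suc n C suc k)
    ≡⟨ cong₂ (λ x y → suc (suc k) * x + suc k * y) (pascal n (suc k)) (pascal n k) ⟩
  suc (suc k) * (b + c) + suc k * (a + b)
    ≡⟨ lhs k a b c ⟩
  (suc (suc k) * c + suc k * b) + (suc k * b + k * a) + (a + b)
    ≡⟨ cong₂ (λ x y → x + y + (a + b)) (absorption n (suc k)) (absorption n k) ⟩
  n * b + n * a + (a + b)
    ≡⟨ rhs n a b ⟩
  suc n * (a + b)
    ≡⟨ cong (suc n *_) (pascal n k) ⟨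
  suc n * (suc n C suc k) ∎
  where
  open ≡-Reasoning
  a = n C k
  b = n C suc k
  c = n C suc (suc k)
  lhs : ∀ k a b c → suc (suc k) * (b + c) + suc k * (a + b) ≡
                    (suc (suc k) * c + suc k * b) + (suc k * b + k * a) + (a + b)
  lhs = solve-∀
  rhs : ∀ n a b → n * b + n * a + (a + b) ≡ suc n * (a + b)
  rhs = solve-∀

C-monoˡ-≤ : ∀ k {m n} → m ≤ n → m C k ≤ n C k
C-monoˡ-≤ zero    _       = ≤-refl
C-monoˡ-≤ (suc k) z≤n     = z≤n
C-monoˡ-≤ (suc k) {suc m} {suc n} (s≤s m≤n) = begin
  suc m C suc k       ≡⟨ pascal m k ⟩
  m C k + m C suc k   ≤⟨ +-mono-≤ (C-monoˡ-≤ k m≤n) (C-monoˡ-≤ (suc k) m≤n) ⟩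
  n C k + n C suc k   ≡⟨ pascal n k ⟨
  suc n C suc k       ∎
  where open ≤-Reasoning

-- Pascal's rule, applied t times, writes C(t + m, k + 1) as C(m, k + 1) plus the sum of C(m + i, k)
-- for i < t. Here each summand is bounded by C(N, k), since m + i ≤ N; the companion below bounds
-- it from below by C(m, k).
C-telescope-≤ : ∀ t {m N} k → t + m ≤ suc N → (t + m) C suc k ≤ m C suc k + t * (N C k)
C-telescope-≤ zero    {m} k _ = ≤-reflexive (sym (+-identityʳ _))
C-telescope-≤ (suc t) {m} {N} k (s≤s p) = begin
  (suc t + m) C suc k                   ≡⟨ pascal (t + m) k ⟩
  (t + m) C k + (t + m) C suc k         ≤⟨ +-mono-≤ (C-monoˡ-≤ k p) (C-telescope-≤ t k (m≤n⇒m≤1+n p)) ⟩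
  N C k + (m C suc k + t * (N C k))     ≡⟨ arith (N C k) (m C suc k) (t * (N C k)) ⟩
  m C suc k + suc t * (N C k)           ∎
  where
  open ≤-Reasoning
  arith : ∀ a b c → a + (b + c) ≡ b + (a + c)
  arith = solve-∀

C-telescope-≥ : ∀ t m k → m C suc k + t * (m C k) ≤ (t + m) C suc k
C-telescope-≥ zero    m k = ≤-reflexive (+-identityʳ _)
C-telescope-≥ (suc t) m k = begin
  m C suc k + (m C k + t * (m C k))     ≡⟨ arith (m C suc k) (m C k) (t * (m C k)) ⟩
  m C k + (m C suc k + t * (m C k))     ≤⟨ +-mono-≤ (C-monoˡ-≤ k (m≤n+m m t)) (C-telescope-≥ t m k) ⟩
  (t + m) C k + (t + m) C suc k         ≡⟨ pascal (t + m) k ⟨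
  (suc t + m) C suc k                   ∎
  where
  open ≤-Reasoning
  arith : ∀ a b c → a + (b + c) ≡ b + (a + c)
  arith = solve-∀

-- Sums over the j-element subsets of a vertex list.

ins : Fin n → Subset n → Subset n
ins v p = p [ v ]≔ inside

ins-idem : ∀ (v : Fin n) p → ins v (ins v p) ≡ ins v p
ins-idem v p = []≔-idempotent p v

ins-comm : ∀ (v w : Fin n) p → ins v (ins w p) ≡ ins w (ins v p)
ins-comm v w p with v Fin.≟ w
... | yes refl = refl
... | no v≢w   = []≔-commutes p w v (v≢w ∘ sym)

fromList : List (Fin n) → Subset n
fromList []      = ⊥
fromList (v ∷ A) = ins v (fromList A)

-- S j L h is the sum of h over the j-element subsets of L, provided that L has
-- no repetitions.
S : ℕ → List (Fin n) → (Subset n → ℕ) → ℕ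
S zero    L       h = h ⊥
S (suc j) []      h = 0
S (suc j) (v ∷ L) h = S (suc j) L h + S j L (h ∘ ins v)

S-mono : ∀ j L {h h′ : Subset n → ℕ} → (∀ p → h p ≤ h′ p) → S j L h ≤ S j L h′
S-mono zero    L       h≤h′ = h≤h′ _
S-mono (suc j) []      h≤h′ = z≤n
S-mono (suc j) (v ∷ L) h≤h′ = +-mono-≤ (S-mono (suc j) L h≤h′) (S-mono j L (h≤h′ ∘ ins v))

S-cong : ∀ j L {h h′ : Subset n → ℕ} → (∀ p → h p ≡ h′ p) → S j L h ≡ S j L h′
S-cong j L eq = ≤-antisym (S-mono j L (≤-reflexive ∘ eq)) (S-mono j L (≤-reflexive ∘ sym ∘ eq))

S-+ : ∀ j L (h h′ : Subset n → ℕ) → S j L (λ p → h p + h′ p) ≡ S j L h + S j L h′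
S-+ zero    L       h h′ = refl
S-+ (suc j) []      h h′ = refl
S-+ (suc j) (v ∷ L) h h′
  rewrite S-+ (suc j) L h h′ | S-+ j L (h ∘ ins v) (h′ ∘ ins v)
  = interchange (S (suc j) L h) (S (suc j) L h′) (S j L (h ∘ ins v)) (S j L (h′ ∘ ins v))
  where
  interchange : ∀ a b c d → a + b + (c + d) ≡ a + c + (b + d)
  interchange = solve-∀

S-↭ : ∀ j {L L′} (h : Subset n → ℕ) → L ↭ L′ → S j L h ≡ S j L′ h
S-↭ zero          h p              = refl
S-↭ (suc j)       h refl           = refl
S-↭ (suc j)       h (prep v p)     = cong₂ _+_ (S-↭ (suc j) h p) (S-↭ j (h ∘ ins v) p)
S-↭ (suc j)       h (trans p q)    = ≡.trans (S-↭ (suc j) h p) (S-↭ (suc j) h q)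
S-↭ (suc zero)    h (swap {xs = L} v w p) rewrite S-↭ 1 h p =
  arith _ (h (ins w ⊥)) (h (ins v ⊥))
  where
  arith : ∀ a b c → a + b + c ≡ a + c + b
  arith = solve-∀
S-↭ (suc (suc j)) h (swap {xs = L} {ys = L′} v w p)
  rewrite S-↭ (suc (suc j)) h p | S-↭ (suc j) (h ∘ ins v) p | S-↭ (suc j) (h ∘ ins w) p
        | S-↭ j (h ∘ ins v ∘ ins w) p | S-cong j L′ {h = h ∘ ins v ∘ ins w} {h ∘ ins w ∘ ins v} (cong h ∘ ins-comm v w)
  = arith (S (suc (suc j)) L′ h) (S (suc j) L′ (h ∘ ins w)) (S (suc j) L′ (h ∘ ins v)) (S j L′ (h ∘ ins w ∘ ins v))
  where
  arith : ∀ a b c d → a + b + (c + d) ≡ a + c + (b + d)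
  arith = solve-∀

S-++ : ∀ j W {L} (h : Subset n → ℕ) → S j L h ≤ S j (W ++ L) h
S-++ j       []      h = ≤-refl
S-++ zero    (w ∷ W) h = ≤-refl
S-++ (suc j) (w ∷ W) h = ≤-trans (S-++ (suc j) W h) (m≤m+n _ _)

S-≤-C : ∀ j L {h : Subset n → ℕ} → (∀ p → h p ≤ 1) → S j L h ≤ length L C j
S-≤-C zero    L       h≤1 = h≤1 _
S-≤-C (suc j) []      h≤1 = z≤n
S-≤-C (suc j) (v ∷ L) h≤1 = begin
  S (suc j) L _ + S j L _              ≤⟨ +-mono-≤ (S-≤-C (suc j) L h≤1) (S-≤-C j L (h≤1 ∘ ins v)) ⟩
  length L C suc j + length L C j      ≡⟨ +-comm (length L C suc j) _ ⟩
  length L C j + length L C suc j      ≡⟨ pascal (length L) j ⟨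
  suc (length L) C suc j               ∎
  where open ≤-Reasoning

-- The vertices of W are removed in turn. Removing w loses the sets through w whose other j elements
-- lie in the rest of the list, at most `N C j` of them.
S-truncate : ∀ j W L {N} {h : Subset n → ℕ} → (∀ p → h p ≤ 1) → length (W ++ L) ≤ suc N →
             S (suc j) (W ++ L) h ≤ S (suc j) L h + length W * (N C j)
S-truncate j []      L h≤1 _ = m≤m+n _ _
S-truncate j (w ∷ W) L {N} {h} h≤1 (s≤s l≤N) = begin
  S (suc j) (W ++ L) h + S j (W ++ L) (h ∘ ins w)
    ≤⟨ +-mono-≤ (S-truncate j W L h≤1 (m≤n⇒m≤1+n l≤N))
                (≤-trans (S-≤-C j (W ++ L) (h≤1 ∘ ins w)) (C-monoˡ-≤ j l≤N)) ⟩
  S (suc j) L h + length W * (N C j) + N C j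
    ≡⟨ arith (S (suc j) L h) (length W) (N C j) ⟩
  S (suc j) L h + suc (length W) * (N C j) ∎
  where
  open ≤-Reasoning
  arith : ∀ a l c → a + l * c + c ≡ a + suc l * c
  arith = solve-∀

-- A set that meets Q is charged to its first vertex in Q. `go` keeps the processed vertices in `W`,
-- so that the degree of the charged vertex can be taken in the whole list `N`.
S-split : ∀ j Q L {N : List (Fin n)} (h : Subset n → ℕ) → Q ++ L ↭ N →
          S (suc j) (Q ++ L) h ≤ S (suc j) L h + ∑ (λ v → S j N (h ∘ ins v)) Q
S-split {n} j Q L {N} h = go [] Q
  where
  go : ∀ W Q → W ++ (Q ++ L) ↭ N → S (suc j) (Q ++ L) h ≤ S (suc j) L h + ∑ (λ v → S j N (h ∘ ins v)) Q
  go W []      p = m≤m+n _ _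
  go W (v ∷ Q) p = begin
    S (suc j) (Q ++ L) h + S j (Q ++ L) (h ∘ ins v)
      ≤⟨ +-mono-≤ (go (v ∷ W) Q (↭-trans (↭-sym (shift v W (Q ++ L))) p))
                  (≤-trans (S-++ j (W ++ v ∷ []) (h ∘ ins v))
                           (≤-reflexive (S-↭ j (h ∘ ins v) (↭-trans (↭-reflexive (++-assoc W (v ∷ []) (Q ++ L))) p)))) ⟩
    S (suc j) L h + ∑ (λ v → S j N (h ∘ ins v)) Q + S j N (h ∘ ins v)
      ≡⟨ arith (S (suc j) L h) (∑ (λ v → S j N (h ∘ ins v)) Q) (S j N (h ∘ ins v)) ⟩
    S (suc j) L h + (S j N (h ∘ ins v) + ∑ (λ v → S j N (h ∘ ins v)) Q) ∎
    where
    open ≤-Reasoning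
    arith : ∀ a b c → a + b + c ≡ a + (c + b)
    arith = solve-∀

-- The union bound, in the form: degrees inside Q overcount by at most |Q| N C j
-- each.
S-union : ∀ j Q L {V : List (Fin n)} {N} (h : Subset n → ℕ) → (∀ p → h p ≤ 1) →
          V ↭ Q ++ L → length V ≤ suc N →
          ∑ (λ v → S (suc j) V (h ∘ ins v)) Q ≤ S (suc (suc j)) (Q ++ L) h + length Q * (length Q * (N C j))
S-union {n} j Q L {V} {N} h h≤1 V↭ lV = go [] Q (↭-sym V↭) ≤-refl
  where
  c = length Q * (N C j)
  go : ∀ W Q′ → W ++ (Q′ ++ L) ↭ V → length W + length Q′ ≤ length Q →
       ∑ (λ v → S (suc j) V (h ∘ ins v)) Q′ ≤ S (suc (suc j)) (Q′ ++ L) h + length Q′ * c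
  go W []       p l = z≤n
  go W (v ∷ Q′) p l = begin
    S (suc j) V (h ∘ ins v) + ∑ (λ v → S (suc j) V (h ∘ ins v)) Q′
      ≤⟨ +-mono-≤ first (go (v ∷ W) Q′ p′ l′) ⟩
    S (suc j) (Q′ ++ L) (h ∘ ins v) + c + (S (suc (suc j)) (Q′ ++ L) h + length Q′ * c)
      ≡⟨ arith (S (suc j) (Q′ ++ L) (h ∘ ins v)) c (S (suc (suc j)) (Q′ ++ L) h) (length Q′) ⟩
    S (suc (suc j)) (Q′ ++ L) h + S (suc j) (Q′ ++ L) (h ∘ ins v) + suc (length Q′) * c ∎
    where
    open ≤-Reasoning
    p′ : v ∷ W ++ (Q′ ++ L) ↭ V
    p′ = ↭-trans (↭-sym (shift v W (Q′ ++ L))) p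
    l′ : suc (length W) + length Q′ ≤ length Q
    l′ = ≤-trans (≤-reflexive (sym (+-suc (length W) (length Q′)))) l
    arith : ∀ a c s q → a + c + (s + q * c) ≡ s + a + suc q * c
    arith = solve-∀
    first : S (suc j) V (h ∘ ins v) ≤ S (suc j) (Q′ ++ L) (h ∘ ins v) + c
    first = begin
      S (suc j) V (h ∘ ins v)
        ≡⟨ S-↭ (suc j) (h ∘ ins v) p′ ⟨
      S (suc j) ((v ∷ W) ++ (Q′ ++ L)) (h ∘ ins v)
        ≤⟨ S-truncate j (v ∷ W) (Q′ ++ L) (h≤1 ∘ ins v) (≤-trans (≤-reflexive (↭-length p′)) lV) ⟩
      S (suc j) (Q′ ++ L) (h ∘ ins v) + length (v ∷ W) * (N C j)
        ≤⟨ +-monoʳ-≤ _ (*-monoˡ-≤ (N C j) (≤-trans (m≤m+n (suc (length W)) (length Q′)) l′)) ⟩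
      S (suc j) (Q′ ++ L) (h ∘ ins v) + c ∎

S-witness : ∀ j L (h : Subset n → ℕ) → 0 < S j L h →
            ∃₂ λ A L′ → L ↭ A ++ L′ × length A ≡ j × 0 < h (fromList A)
S-witness zero    L       h 0<S = [] , L , ↭-refl , refl , 0<S
S-witness (suc j) (v ∷ L) h 0<S with S (suc j) L h in eq
... | zero with A , L′ , p , l , q ← S-witness j L (h ∘ ins v) 0<S = v ∷ A , L′ , prep v p , cong suc l , q
... | suc _ with A , L′ , p , l , q ← S-witness (suc j) L h (subst (0 <_) (sym eq) (s≤s z≤n)) =
  A , v ∷ L′ , ↭-trans (prep v p) (↭-sym (shift v A L′)) , l , q

-- Inserting a vertex that is already present yields a set that is too small. This condition makes
-- such degenerate terms vanish, so that degrees may be taken in lists containing the vertex itself.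
VanishesBelow : ℕ → (Subset n → ℕ) → Set
VanishesBelow {n} j h = ∀ (A : List (Fin n)) → length A < j → h (fromList A) ≡ 0

VanishesBelow-ins : ∀ {j} (h : Subset n → ℕ) v → VanishesBelow (suc j) h → VanishesBelow j (h ∘ ins v)
VanishesBelow-ins h v van A l = van (v ∷ A) (s≤s l)

S-vanish : ∀ j L (h : Subset n → ℕ) → VanishesBelow (suc j) h → S j L h ≡ 0
S-vanish zero    L       h van = van [] (s≤s z≤n)
S-vanish (suc j) []      h van = refl
S-vanish (suc j) (v ∷ L) h van = cong₂ _+_ (S-vanish (suc j) L h van) (S-vanish j L _ (VanishesBelow-ins h v van))

S-vanish-ins² : ∀ j L (h : Subset n → ℕ) v → VanishesBelow (suc (suc j)) h → S j L (h ∘ ins v ∘ ins v) ≡ 0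
S-vanish-ins² j L h v van = ≡.trans (S-cong j L (cong h ∘ ins-idem v)) (S-vanish j L _ (VanishesBelow-ins h v van))

-- Double counting: each (j + 1)-set is counted once for each of its vertices. The terms in which x
-- already lies in the chosen j-set vanish.
S-degree-sum : ∀ j L (h : Subset n → ℕ) → VanishesBelow (suc j) h →
               ∑ (λ x → S j L (h ∘ ins x)) L ≡ suc j * S (suc j) L h
S-degree-sum j       []      h van = sym (*-zeroʳ (suc j))
S-degree-sum zero    (y ∷ L) h van = begin
  h (ins y ⊥) + ∑ (λ x → h (ins x ⊥)) L   ≡⟨ cong (_+_ (h (ins y ⊥))) (S-degree-sum zero L h van) ⟩
  h (ins y ⊥) + 1 * S 1 L h               ≡⟨ arith (h (ins y ⊥)) (S 1 L h) ⟩
  1 * (S 1 L h + h (ins y ⊥))             ∎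
  where
  open ≡-Reasoning
  arith : ∀ a b → a + 1 * b ≡ 1 * (b + a)
  arith = solve-∀
S-degree-sum (suc j) (y ∷ L) h van = begin
  S (suc j) L (h ∘ ins y) + S j L (h ∘ ins y ∘ ins y) + ∑ (λ x → S (suc j) L (h ∘ ins x) + S j L (h ∘ ins x ∘ ins y)) L
    ≡⟨ cong₂ _+_ (cong (_+_ a) (S-vanish-ins² j L h y van)) (∑-+ (λ x → S (suc j) L (h ∘ ins x)) (λ x → S j L (h ∘ ins x ∘ ins y)) L) ⟩
  a + 0 + (∑ (λ x → S (suc j) L (h ∘ ins x)) L + ∑ (λ x → S j L (h ∘ ins x ∘ ins y)) L)
    ≡⟨ cong₂ (λ u v → a + 0 + (u + v)) (S-degree-sum (suc j) L h van)
         (≡.trans (∑-cong (λ x → S-cong j L (cong h ∘ ins-comm x y)) L)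
                  (S-degree-sum j L (h ∘ ins y) (VanishesBelow-ins h y van))) ⟩
  a + 0 + (suc (suc j) * b + suc j * a)
    ≡⟨ arith j a b ⟩
  suc (suc j) * (b + a) ∎
  where
  open ≡-Reasoning
  a = S (suc j) L (h ∘ ins y)
  b = S (suc (suc j)) L h
  arith : ∀ j a b → a + 0 + (suc (suc j) * b + suc j * a) ≡ suc (suc j) * (b + a)
  arith = solve-∀

-- Averaging over the rotations of a list.

pair : List (A → ℕ) → List A → ℕ
pair []      xs       = 0
pair (h ∷ H) []       = 0
pair (h ∷ H) (x ∷ xs) = h x + pair H xs

-- rots X Y lists the rotations of X ++ Y that begin with an element of X.
rots : List A → List A → List (List A)
rots []      Y = []
rots (x ∷ X) Y = (x ∷ X ++ Y) ∷ rots X (Y ++ x ∷ [])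

length-rots : ∀ (X Y : List A) → length (rots X Y) ≡ length X
length-rots []      Y = refl
length-rots (x ∷ X) Y = cong suc (length-rots X (Y ++ x ∷ []))

rots-↭ : ∀ (X Y : List A) → All (_↭ X ++ Y) (rots X Y)
rots-↭ []      Y = []
rots-↭ (x ∷ X) Y = ↭-refl ∷ All.map (λ p → ↭-trans p step) (rots-↭ X (Y ++ x ∷ []))
  where
  step : X ++ (Y ++ x ∷ []) ↭ x ∷ X ++ Y
  step = ↭-trans (↭-reflexive (sym (++-assoc X Y (x ∷ [])))) (↭-sym (∷↭∷ʳ x (X ++ Y)))

pair-++ : ∀ (H : List (A → ℕ)) X Y → length H ≤ length X → pair H (X ++ Y) ≡ pair H X
pair-++ []      X       Y _       = refl
pair-++ (h ∷ H) (x ∷ X) Y (s≤s l) = cong (_+_ (h x)) (pair-++ H X Y l)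

-- Without its head, a rotation agrees with the next rotation in all positions that `pair H` reads,
-- because H is shorter than the list. The two sums are therefore shifted by one term and differ
-- only by the terms at the two ends, X ++ Y and Y ++ X.
∑-rots-tail : ∀ (H : List (A → ℕ)) X Y → length H < length X + length Y →
              ∑ (pair H ∘ drop 1) (rots X Y) + pair H (X ++ Y) ≡ ∑ (pair H) (rots X Y) + pair H (Y ++ X)
∑-rots-tail H []      Y l       = cong (pair H) (sym (++-identityʳ Y))
∑-rots-tail H (x ∷ X) Y (s≤s l) = begin
  pair H (X ++ Y) + σ + pair H (x ∷ X ++ Y)
    ≡⟨ cong (λ t → t + σ + pair H (x ∷ X ++ Y)) unrotate ⟩
  pair H (X ++ Y′) + σ + pair H (x ∷ X ++ Y)
    ≡⟨ arith₁ (pair H (X ++ Y′)) σ (pair H (x ∷ X ++ Y)) ⟩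
  pair H (x ∷ X ++ Y) + (σ + pair H (X ++ Y′))
    ≡⟨ cong (_+_ (pair H (x ∷ X ++ Y))) (∑-rots-tail H X Y′ l′) ⟩
  pair H (x ∷ X ++ Y) + (∑ (pair H) (rots X Y′) + pair H (Y′ ++ X))
    ≡⟨ cong (λ Z → pair H (x ∷ X ++ Y) + (∑ (pair H) (rots X Y′) + pair H Z)) (++-assoc Y (x ∷ []) X) ⟩
  pair H (x ∷ X ++ Y) + (∑ (pair H) (rots X Y′) + pair H (Y ++ x ∷ X))
    ≡⟨ +-assoc (pair H (x ∷ X ++ Y)) _ _ ⟨
  pair H (x ∷ X ++ Y) + ∑ (pair H) (rots X Y′) + pair H (Y ++ x ∷ X) ∎
  where
  open ≡-Reasoning
  Y′ = Y ++ x ∷ []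
  σ = ∑ (pair H ∘ drop 1) (rots X Y′)
  l′ : length H < length X + length Y′
  l′ = ≤-trans (s≤s l) (≤-reflexive (≡.trans (sym (+-suc (length X) (length Y)))
         (cong (_+_ (length X)) (sym (≡.trans (length-++ Y) (+-comm (length Y) 1))))))
  unrotate : pair H (X ++ Y) ≡ pair H (X ++ Y′)
  unrotate = ≡.trans (sym (pair-++ H (X ++ Y) (x ∷ []) (≤-trans l (≤-reflexive (sym (length-++ X))))))
                     (cong (pair H) (++-assoc X Y (x ∷ [])))
  arith₁ : ∀ a b c → a + b + c ≡ c + (b + a)
  arith₁ = solve-∀

∑-rots-∷ : ∀ h (H : List (A → ℕ)) X Y →
           ∑ (pair (h ∷ H)) (rots X Y) ≡ ∑ h X + ∑ (pair H ∘ drop 1) (rots X Y)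
∑-rots-∷ h H []      Y = refl
∑-rots-∷ h H (x ∷ X) Y rewrite ∑-rots-∷ h H X (Y ++ x ∷ []) =
  arith (h x) (pair H (X ++ Y)) (∑ h X) (∑ (pair H ∘ drop 1) (rots X (Y ++ x ∷ [])))
  where
  arith : ∀ a b c d → a + b + (c + d) ≡ a + c + (b + d)
  arith = solve-∀

-- The heads of the rotations run once through E and account for the first function. For the
-- remaining functions the tails are as good as the rotations: when Y is empty, the two end terms of
-- `∑-rots-tail` coincide.
∑-rots : ∀ (H : List (A → ℕ)) E → length H ≤ length E →
         ∑ (pair H) (rots E []) ≡ ∑ (λ h → ∑ h E) H
∑-rots []      E l = ≡.trans (∑-const 0 (rots E [])) (*-zeroʳ (length (rots E [])))
∑-rots (h ∷ H) E l = ≡.trans (∑-rots-∷ h H E []) (cong (_+_ (∑ h E)) (≡.trans untail (∑-rots H E (<⇒≤ l))))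
  where
  untail : ∑ (pair H ∘ drop 1) (rots E []) ≡ ∑ (pair H) (rots E [])
  untail = +-cancelʳ-≡ (pair H E) _ _
    (≡.trans (cong (λ Z → ∑ (pair H ∘ drop 1) (rots E []) + pair H Z) (sym (++-identityʳ E)))
             (∑-rots-tail H E [] (≤-trans l (≤-reflexive (sym (+-identityʳ _))))))

-- Every element of E occurs once in each position among the rotations of E, so
-- one of them is at most the average.
∃-rotation : ∀ (H : List (A → ℕ)) E → length H ≤ length E → 0 < length E →
             ∃[ E′ ] E′ ↭ E × length E * pair H E′ ≤ ∑ (λ h → ∑ h E) H
∃-rotation H E l 0<E
  with E′ , _ , p , q ← ∃-≤-average (pair H) (rots E []) (≤-trans 0<E (≤-reflexive (sym (length-rots E []))))
  with E′↭ ∷ _ ← All-resp-↭ p (rots-↭ E [])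
  = E′ , ↭-trans E′↭ (↭-reflexive (++-identityʳ E)) ,
    ≤-trans (≤-reflexive (cong (_* pair H E′) (sym (length-rots E [])))) (≤-trans q (≤-reflexive (∑-rots H E l)))

-- Disjoint transversals of blocks.

-- T j L h is the sum of h over the j-element sets that meet each of j blocks of
-- L in one vertex and are contained in their union.
T : ℕ → List (List (Fin n)) → (Subset n → ℕ) → ℕ
T zero    L       h = h ⊥
T (suc j) []      h = 0
T (suc j) (E ∷ L) h = T (suc j) L h + ∑ (λ v → T j L (h ∘ ins v)) E

T-≤-S : ∀ j L (h : Subset n → ℕ) → T j L h ≤ S j (concat L) h
T-≤-S zero    L       h = ≤-refl
T-≤-S (suc j) []      h = ≤-refl
T-≤-S (suc j) (E ∷ L) h = ≤-trans
  (+-mono-≤ (T-≤-S (suc j) L h) (∑-mono (λ v → T-≤-S j L (h ∘ ins v)) E))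
  (split E)
  where
  split : ∀ E → S (suc j) (concat L) h + ∑ (λ v → S j (concat L) (h ∘ ins v)) E ≤ S (suc j) (E ++ concat L) h
  split []      = ≤-reflexive (+-identityʳ _)
  split (v ∷ E) = begin
    S (suc j) (concat L) h + (S j (concat L) (h ∘ ins v) + ∑ (λ v → S j (concat L) (h ∘ ins v)) E)
      ≡⟨ arith (S (suc j) (concat L) h) _ _ ⟩
    S (suc j) (concat L) h + ∑ (λ v → S j (concat L) (h ∘ ins v)) E + S j (concat L) (h ∘ ins v)
      ≤⟨ +-mono-≤ (split E) (S-++ j E (h ∘ ins v)) ⟩
    S (suc j) (E ++ concat L) h + S j (E ++ concat L) (h ∘ ins v) ∎
    where
    open ≤-Reasoning
    arith : ∀ a b c → a + (b + c) ≡ a + c + b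
    arith = solve-∀

Avoids : ℕ → (Subset n → ℕ) → List (Fin n) → Set
Avoids j h A = length A ≡ j × h (fromList A) ≡ 0

-- The i-th function judges the i-th transversal under construction; this is its form once that
-- transversal has received the i-th vertex of a block.
extend : List (Subset n → ℕ) → List (Fin n) → List (Subset n → ℕ)
extend = zipWith (λ h v → h ∘ ins v)

length-extend : ∀ (hs : List (Subset n → ℕ)) E → length E ≡ length hs → length (extend hs E) ≡ length hs
length-extend []       []      _ = refl
length-extend (h ∷ hs) (v ∷ E) l = cong suc (length-extend hs E (suc-injective l))

pair-extend : ∀ (φ : (Subset n → ℕ) → ℕ) hs E →
              pair (map (λ h v → φ (h ∘ ins v)) hs) E ≡ ∑ φ (extend hs E)
pair-extend φ []       E       = refl
pair-extend φ (h ∷ hs) []      = refl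
pair-extend φ (h ∷ hs) (v ∷ E) = cong (_+_ (φ (h ∘ ins v))) (pair-extend φ hs E)

∑-map : ∀ (f : B → ℕ) (g : A → B) xs → ∑ f (map g xs) ≡ ∑ (f ∘ g) xs
∑-map f g []       = refl
∑-map f g (x ∷ xs) = cong (_+_ (f (g x))) (∑-map f g xs)

Avoids-zipWith : ∀ {j} (hs : List (Subset n → ℕ)) E {As} → length E ≡ length hs →
                 Pointwise (Avoids j) (extend hs E) As → Pointwise (Avoids (suc j)) hs (zipWith _∷_ E As)
Avoids-zipWith []       []      l [] = []
Avoids-zipWith (h ∷ hs) (v ∷ E) l ((lA , hA) ∷ ps) = (cong suc lA , hA) ∷ Avoids-zipWith hs E (suc-injective l) ps

concat-zipWith-∷ : ∀ (E : List A) As → length As ≡ length E → concat (zipWith _∷_ E As) ↭ E ++ concat As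
concat-zipWith-∷ []      []       l = ↭-refl
concat-zipWith-∷ (v ∷ E) (A ∷ As) l =
  prep v (↭-trans (++⁺ˡ A (concat-zipWith-∷ E As (suc-injective l))) (shifts A E))

Pointwise-length : ∀ {R : A → B → Set} {xs ys} → Pointwise R xs ys → length xs ≡ length ys
Pointwise-length []       = refl
Pointwise-length (_ ∷ ps) = cong suc (Pointwise-length ps)

∑-zero : ∀ (f : A → ℕ) xs → ∑ f xs ≡ 0 → All (λ x → f x ≡ 0) xs
∑-zero f []       _  = []
∑-zero f (x ∷ xs) eq = m+n≡0⇒m≡0 (f x) eq ∷ ∑-zero f xs (m+n≡0⇒n≡0 (f x) eq)

-- The method of conditional expectations. There are `k ^ j * (length L C j)` transversals of j
-- blocks, so the hypothesis says that a random system of k disjoint transversals has expected total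
-- value below 1. The first block E is skipped if the hypothesis survives without it. Otherwise
-- Pascal's rule leaves the systems using E with an expectation below 1, and some rotation of E
-- deals its k vertices to the k transversals at no more than the average cost. For j = 0 the total
-- is below 1, hence every value is 0.
avoiding-transversals : ∀ {k} j L (hs : List (Subset n → ℕ)) →
  All (λ E → length E ≡ k) L → length hs ≡ k → ∑ (T j L) hs < k ^ j * (length L C j) →
  ∃ λ As → ∃₂ λ Ls Ls′ → L ↭ Ls ++ Ls′ × length Ls ≡ j × concat As ↭ concat Ls ×
  Pointwise (Avoids j) hs As
avoiding-transversals zero L hs _ _ ∑<1 =
  map (λ _ → []) hs , [] , L , ↭-refl , refl , ↭-reflexive (concat-[] hs) , avoid (∑-zero _ hs (n<1⇒n≡0 ∑<1))
  where
  concat-[] : ∀ hs → concat (map (λ _ → []) hs) ≡ []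
  concat-[] []       = refl
  concat-[] (h ∷ hs) = concat-[] hs
  avoid : ∀ {hs} → All (λ h → h ⊥ ≡ 0) hs → Pointwise (Avoids 0) hs (map (λ _ → []) hs)
  avoid []       = []
  avoid (p ∷ ps) = (refl , p) ∷ avoid ps
avoiding-transversals {k = k} (suc j) [] hs _ _ ∑< = contradiction (≤-trans ∑< (≤-reflexive (*-zeroʳ (k ^ suc j)))) λ ()
avoiding-transversals {n} {k = k} (suc j) (E ∷ L) hs (lE ∷ lL) lhs ∑<
  with ∑ (T (suc j) L) hs <? k ^ suc j * (length L C suc j)
... | yes skip with As , Ls , Ls′ , p , l , q , av ← avoiding-transversals (suc j) L hs lL lhs skip =
  As , Ls , E ∷ Ls′ , ↭-trans (prep E p) (↭-sym (shift E Ls Ls′)) , l , q , av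
... | no ¬skip = use
  where
  use₁ : ∑ (λ h → ∑ (λ v → T j L (h ∘ ins v)) E) hs < k * (k ^ j * (length L C j))
  use₁ = +-cancelˡ-< (∑ (T (suc j) L) hs) _ _ (begin-strict
    ∑ (T (suc j) L) hs + ∑ (λ h → ∑ (λ v → T j L (h ∘ ins v)) E) hs
      ≡⟨ ∑-+ (T (suc j) L) (λ h → ∑ (λ v → T j L (h ∘ ins v)) E) hs ⟨
    ∑ (T (suc j) (E ∷ L)) hs
      <⟨ ∑< ⟩
    k ^ suc j * (suc (length L) C suc j)
      ≡⟨ cong (_*_ (k ^ suc j)) (pascal (length L) j) ⟩
    k ^ suc j * (length L C j + length L C suc j)
      ≡⟨ arith k (k ^ j) (length L C j) (length L C suc j) ⟩
    k ^ suc j * (length L C suc j) + k * (k ^ j * (length L C j))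
      ≤⟨ +-monoˡ-≤ _ (≮⇒≥ ¬skip) ⟩
    ∑ (T (suc j) L) hs + k * (k ^ j * (length L C j)) ∎)
    where
    open ≤-Reasoning
    arith : ∀ k x a b → k * x * (a + b) ≡ k * x * b + k * (x * a)
    arith = solve-∀
  H = map (λ h v → T j L (h ∘ ins v)) hs
  0<k : 0 < k
  0<k = n≢0⇒n>0 λ { refl → contradiction use₁ λ () }
  use : _
  use
    with E′ , E′↭E , avg ← ∃-rotation H E (≤-reflexive (≡.trans (length-map _ hs) (≡.trans lhs (sym lE)))) (subst (0 <_) (sym lE) 0<k)
    with lE′ ← ≡.trans (↭-length E′↭E) (≡.trans lE (sym lhs))
    with As , Ls , Ls′ , p , l , q , av ← avoiding-transversals j L (extend hs E′) lL (≡.trans (length-extend hs E′ lE′) lhs)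
           (*-cancelˡ-< k _ _ (≤-trans (s≤s (≤-trans (≤-reflexive (cong₂ _*_ (sym lE) (sym (pair-extend (T j L) hs E′))))
             (≤-trans avg (≤-reflexive (∑-map (λ h → ∑ h E) (λ h v → T j L (h ∘ ins v)) hs))))) use₁))
    = zipWith _∷_ E′ As , E ∷ Ls , Ls′ , prep E p , cong suc l ,
      ↭-trans (concat-zipWith-∷ E′ As (≡.trans (sym (Pointwise-length av)) (≡.trans (length-extend hs E′ lE′) (sym lE′))))
              (++⁺ E′↭E q) ,
      Avoids-zipWith hs E′ lE′ av

-- Repartitioning blocks into good ones.

exchange-heads : ∀ (x z : A) X Z Y → (x ∷ X) ++ ((z ∷ Z) ++ Y) ↭ (z ∷ X) ++ ((x ∷ Z) ++ Y)
exchange-heads x z X Z Y =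
  ↭-trans (prep x (shift z X (Z ++ Y))) (↭-trans (swap x z ↭-refl) (prep z (↭-sym (shift x X (Z ++ Y)))))

-- g marks the bad sets, and blocks have suc κ vertices.
module Repartition {n : ℕ} (κ : ℕ) (g : Subset n → ℕ) (g≤1 : ∀ p → g p ≤ 1) (V : List (Fin n)) where

  deg : Fin n → ℕ
  deg x = S κ V (g ∘ ins x)

  weight : List (Fin n) → ℕ
  weight = ∑ deg

  Block Good : List (Fin n) → Set
  Block e = length e ≡ suc κ
  Good e = Block e × g (fromList e) ≡ 0

  -- A bad block costs 1 plus its weight. The 1 makes it profitable to remove a bad block of weight
  -- 0, and the weight makes it profitable to replace a bad block by a lighter one that may still be
  -- bad.
  penalty : List (Fin n) → ℕ
  penalty e = g (fromList e) * suc (weight e)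

  Φ : List (List (Fin n)) → ℕ
  Φ = ∑ penalty

  Φ-good : ∀ {P} → All Good P → Φ P ≡ 0
  Φ-good []                 = refl
  Φ-good ((_ , ge) ∷ goods) rewrite ge = Φ-good goods

  good-Φ : ∀ P → All Block P → Φ P ≡ 0 → All Good P
  good-Φ []      []       _  = []
  good-Φ (e ∷ P) (b ∷ bs) eq =
    (b , m*n≡0⇒m≡0 (g (fromList e)) (suc (weight e)) (m+n≡0⇒m≡0 (penalty e) eq)) ∷ good-Φ P bs (m+n≡0⇒n≡0 (penalty e) eq)

  ∑T-≤-weight : ∀ {Z} e L → Z ++ (e ++ concat L) ↭ V → ∑ (T κ L) (map (λ x → g ∘ ins x) e) ≤ weight e
  ∑T-≤-weight {Z} e L p = ≤-trans (≤-reflexive (∑-map (T κ L) (λ x → g ∘ ins x) e))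
    (∑-mono (λ x → ≤-trans (T-≤-S κ L (g ∘ ins x)) (≤-trans (S-++ κ (Z ++ e) (g ∘ ins x))
      (≤-reflexive (S-↭ κ (g ∘ ins x) (↭-trans (↭-reflexive (++-assoc Z e (concat L))) p))))) e)

  -- The functions `g ∘ ins x` for x in e have total expectation below 1 when the weight of e is
  -- below the number of transversals. Hence e and κ blocks of L can be recut into κ + 1 good
  -- blocks, one through each vertex of e; the other blocks of L stay as they are.
  switch : ∀ {Z} e L → Block e → All Block L → Z ++ (e ++ concat L) ↭ V →
           weight e < suc κ ^ κ * (length L C κ) →
           ∃ λ P → All Block P × concat P ↭ e ++ concat L × Φ P ≤ Φ L × length P ≡ suc (length L)
  switch {Z} e L be bL p w<
    with As , Ls , Ls′ , L↭ , l , q , av ← avoiding-transversals κ L (map (λ x → g ∘ ins x) e) bL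
           (≡.trans (length-map _ e) be) (≤-trans (s≤s (∑T-≤-weight {Z} e L p)) w<)
    = new ++ Ls′ , All.++⁺ (All.map proj₁ new-good) (All.++⁻ʳ Ls (All-resp-↭ L↭ bL)) ,
      perm , Φ-bound , len
    where
    new = zipWith _∷_ e As
    goods : ∀ e {As} → Pointwise (Avoids κ) (map (λ x → g ∘ ins x) e) As → All Good (zipWith _∷_ e As)
    goods []      []                 = []
    goods (x ∷ e) ((lA , gA) ∷ avs) = (cong suc lA , gA) ∷ goods e avs
    new-good : All Good new
    new-good = goods e av
    lAs : length As ≡ length e
    lAs = ≡.trans (sym (Pointwise-length av)) (length-map _ e)
    perm : concat (new ++ Ls′) ↭ e ++ concat L
    perm = ↭-trans (↭-reflexive (sym (concat-++ new Ls′)))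
      (↭-trans (++⁺ʳ (concat Ls′) (↭-trans (concat-zipWith-∷ e As lAs) (++⁺ˡ e q)))
      (↭-trans (↭-reflexive (++-assoc e (concat Ls) (concat Ls′)))
      (++⁺ˡ e (↭-trans (↭-reflexive (concat-++ Ls Ls′)) (↭-sym (concat-↭ L↭))))))
    Φ-bound : Φ (new ++ Ls′) ≤ Φ L
    Φ-bound = begin
      Φ (new ++ Ls′)     ≡⟨ ∑-++ penalty new Ls′ ⟩
      Φ new + Φ Ls′      ≡⟨ cong (_+ Φ Ls′) (Φ-good new-good) ⟩
      Φ Ls′              ≤⟨ m≤n+m _ (Φ Ls) ⟩
      Φ Ls + Φ Ls′       ≡⟨ ∑-++ penalty Ls Ls′ ⟨
      Φ (Ls ++ Ls′)      ≡⟨ ∑-↭ penalty L↭ ⟨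
      Φ L                ∎
      where open ≤-Reasoning
    length-zipWith-∷ : ∀ (e : List (Fin n)) As → length As ≡ length e → length (zipWith _∷_ e As) ≡ length e
    length-zipWith-∷ []      []       _ = refl
    length-zipWith-∷ (x ∷ e) (A ∷ As) l = cong suc (length-zipWith-∷ e As (suc-injective l))
    len : length (new ++ Ls′) ≡ suc (length L)
    len = begin
      length (new ++ Ls′)          ≡⟨ length-++ new ⟩
      length new + length Ls′
        ≡⟨ cong (_+ length Ls′) (≡.trans (length-zipWith-∷ e As lAs) (≡.trans be (cong suc (sym l)))) ⟩
      suc (length Ls + length Ls′) ≡⟨ cong suc (length-++ Ls) ⟨
      suc (length (Ls ++ Ls′))     ≡⟨ cong suc (↭-length L↭) ⟨
      suc (length L)               ∎
      where open ≡-Reasoning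

  -- A partition has m + 2 blocks. With one block set aside, `total` gives average weight at most
  -- c/8 among the other m + 1; with two set aside, `transversals` gives at least 3c/4 transversals
  -- of the remaining m. A light vertex has degree below c/2, and 1/2 + 1/8 < 3/4.
  module _ (c m : ℕ)
           (transversals : 3 * c ≤ 4 * (suc κ ^ κ * (m C κ)))
           (total : 8 * ∑ deg V ≤ suc m * c) where

    Light : Fin n → Set
    Light x = 2 * deg x < c

    private
      K = suc κ ^ κ * (m C κ)

      light-average : ∀ a b → 2 * a < c → 8 * b ≤ c → a + b < K
      light-average a b 2a<c 8b≤c = *-cancelˡ-< 8 _ _ (begin-strict
        8 * (a + b)          ≡⟨ arith₁ a b ⟩
        4 * (2 * a) + 8 * b  <⟨ +-mono-<-≤ (*-monoʳ-< 4 2a<c) 8b≤c ⟩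
        4 * c + c            ≤⟨ m≤m+n (4 * c + c) c ⟩
        4 * c + c + c        ≡⟨ arith₂ c ⟩
        2 * (3 * c)          ≤⟨ *-monoʳ-≤ 2 transversals ⟩
        2 * (4 * K)          ≡⟨ arith₃ K ⟩
        8 * K                ∎)
        where
        open ≤-Reasoning
        arith₁ : ∀ a b → 8 * (a + b) ≡ 4 * (2 * a) + 8 * b
        arith₁ = solve-∀
        arith₂ : ∀ c → 4 * c + c + c ≡ 2 * (3 * c)
        arith₂ = solve-∀
        arith₃ : ∀ c → 2 * (4 * c) ≡ 8 * c
        arith₃ = solve-∀

    -- A block e of at least average penalty is bad because `Φ P` is positive. If its weight is
    -- small, `switch` applies to it directly. If not, a vertex x of high degree in e is exchanged
    -- with a vertex z of low degree in a block `E₀` of low weight. Then `x ∷ E₁` has weight below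
    -- c/2 + c/8, so `switch` applies to it, and `z ∷ e₁` is lighter than e.
    improve : ∀ {Z} P → length P ≡ suc (suc m) → All Block P → Z ++ concat P ↭ V →
              All Light (concat P) → 0 < Φ P →
              ∃ λ P′ → length P′ ≡ suc (suc m) × All Block P′ × concat P′ ↭ concat P × Φ P′ < Φ P
    improve {Z} P lP bP pV light 0<Φ
      with e , L , P↭ , avg ← ∃-≥-average penalty P (subst (0 <_) (sym lP) (s≤s z≤n))
      with be ∷ bL ← All-resp-↭ P↭ bP
      = go
      where
      lL : length L ≡ suc m
      lL = suc-injective (≡.trans (sym (↭-length P↭)) lP)
      pV′ : Z ++ (e ++ concat L) ↭ V
      pV′ = ↭-trans (++⁺ˡ Z (↭-sym (concat-↭ P↭))) pV
      0<ge : 0 < g (fromList e)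
      0<ge = n≢0⇒n>0 λ ge≡0 → <⇒≢ (≤-trans 0<Φ (≤-trans avg (≤-reflexive
        (≡.trans (cong (λ t → length P * (t * suc (weight e))) ge≡0) (*-zeroʳ (length P)))))) refl
      penalty-e : suc (weight e) ≤ penalty e
      penalty-e = ≤-trans (≤-reflexive (sym (*-identityˡ _))) (*-monoˡ-≤ (suc (weight e)) 0<ge)

      ΦP : Φ P ≡ penalty e + Φ L
      ΦP = ∑-↭ penalty P↭

      go : ∃ λ P′ → length P′ ≡ suc (suc m) × All Block P′ × concat P′ ↭ concat P × Φ P′ < Φ P
      go with weight e <? suc κ ^ κ * (length L C κ)
      ... | yes w<
        = let P′ , bP′ , p′ , ΦP′ , lP′ = switch {Z} e L be bL pV′ w< in
          P′ , ≡.trans lP′ (cong suc lL) , bP′ , ↭-trans p′ (↭-sym (concat-↭ P↭)) ,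
          ≤-trans (s≤s ΦP′) (≤-trans (+-monoˡ-≤ (Φ L) (≤-trans (s≤s z≤n) penalty-e)) (≤-reflexive (sym ΦP)))
      ... | no ¬w<
        with x , e₁ , e↭ , x-avg ← ∃-≥-average deg e (subst (0 <_) (sym be) (s≤s z≤n))
        with E₀ , L₂ , L↭ , E₀-avg ← ∃-≤-average weight L (subst (0 <_) (sym lL) (s≤s z≤n))
        with bE₀ ∷ bL₂ ← All-resp-↭ L↭ bL
        with z , E₁ , E₀↭ , z-avg ← ∃-≤-average deg E₀ (subst (0 <_) (sym bE₀) (s≤s z≤n))
        = exchange
        where
        lL₂ : length L₂ ≡ m
        lL₂ = suc-injective (≡.trans (sym (↭-length L↭)) lL)
        concatP : concat P ↭ (x ∷ e₁) ++ ((z ∷ E₁) ++ concat L₂)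
        concatP = ↭-trans (concat-↭ P↭) (++⁺ e↭ (↭-trans (concat-↭ L↭) (++⁺ʳ (concat L₂) E₀↭)))
        2dx<c : 2 * deg x < c
        2dx<c = All.head (All-resp-↭ concatP light)
        8wE₀≤c : 8 * weight E₀ ≤ c
        8wE₀≤c = *-cancelˡ-≤ (suc m) (begin
          suc m * (8 * weight E₀)         ≡⟨ arith (suc m) (weight E₀) ⟩
          8 * (suc m * weight E₀)         ≡⟨ cong (λ l → 8 * (l * weight E₀)) lL ⟨
          8 * (length L * weight E₀)      ≤⟨ *-monoʳ-≤ 8 E₀-avg ⟩
          8 * ∑ weight L                  ≡⟨ cong (_*_ 8) (∑-concat deg L) ⟨
          8 * ∑ deg (concat L)            ≤⟨ *-monoʳ-≤ 8 (m≤n+m _ (∑ deg (Z ++ e))) ⟩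
          8 * (∑ deg (Z ++ e) + ∑ deg (concat L)) ≡⟨ cong (_*_ 8) (∑-++ deg (Z ++ e) (concat L)) ⟨
          8 * ∑ deg ((Z ++ e) ++ concat L)
            ≡⟨ cong (_*_ 8) (∑-↭ deg (↭-trans (↭-reflexive (++-assoc Z e (concat L))) pV′)) ⟩
          8 * ∑ deg V                     ≤⟨ total ⟩
          suc m * c                       ∎)
          where
          open ≤-Reasoning
          arith : ∀ a b → a * (8 * b) ≡ 8 * (a * b)
          arith = solve-∀
        wE₀<K : weight E₀ < K
        wE₀<K = light-average 0 (weight E₀) (≤-trans (s≤s z≤n) 2dx<c) 8wE₀≤c
        -- The average degree is below K / k in `E₀` and at least K / k in e, where k is the block
        -- size.
        dz<dx : deg z < deg x
        dz<dx = *-cancelˡ-< (suc κ) _ _ (begin-strict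
          suc κ * deg z       ≡⟨ cong (_* deg z) bE₀ ⟨
          length E₀ * deg z   ≤⟨ z-avg ⟩
          weight E₀           <⟨ wE₀<K ⟩
          K
            ≤⟨ *-monoʳ-≤ (suc κ ^ κ) (C-monoˡ-≤ κ (≤-trans (n≤1+n m) (≤-reflexive (sym lL)))) ⟩
          suc κ ^ κ * (length L C κ) ≤⟨ ≮⇒≥ ¬w< ⟩
          weight e            ≤⟨ x-avg ⟩
          length e * deg x    ≡⟨ cong (_* deg x) be ⟩
          suc κ * deg x       ∎)
          where open ≤-Reasoning
        wE₁≤wE₀ : weight E₁ ≤ weight E₀
        wE₁≤wE₀ = ≤-trans (m≤n+m _ (deg z)) (≤-reflexive (sym (∑-↭ deg E₀↭)))
        w< : weight (x ∷ E₁) < suc κ ^ κ * (length L₂ C κ)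
        w< = ≤-trans (s≤s (+-monoʳ-≤ (deg x) wE₁≤wE₀))
               (≤-trans (light-average (deg x) (weight E₀) 2dx<c 8wE₀≤c) (≤-reflexive (cong (λ t → suc κ ^ κ * (t C κ)) (sym lL₂))))
        exchanged : concat P ↭ (z ∷ e₁) ++ ((x ∷ E₁) ++ concat L₂)
        exchanged = ↭-trans concatP (exchange-heads x z e₁ E₁ (concat L₂))
        pV″ : (Z ++ z ∷ e₁) ++ ((x ∷ E₁) ++ concat L₂) ↭ V
        pV″ = ↭-trans (↭-reflexive (++-assoc Z (z ∷ e₁) _)) (↭-trans (++⁺ˡ Z (↭-sym exchanged)) pV)
        exchange : ∃ λ P′ → length P′ ≡ suc (suc m) × All Block P′ × concat P′ ↭ concat P × Φ P′ < Φ P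
        exchange =
          let P′ , bP′ , p′ , ΦP′ , lP′ = switch {Z ++ z ∷ e₁} (x ∷ E₁) L₂ (≡.trans (sym (↭-length E₀↭)) bE₀) bL₂ pV″ w< in
            (z ∷ e₁) ∷ P′ , cong suc (≡.trans lP′ (cong suc lL₂)) , ≡.trans (sym (↭-length e↭)) be ∷ bP′ ,
            ↭-trans (++⁺ˡ (z ∷ e₁) p′) (↭-sym exchanged) ,
            (begin-strict
              penalty (z ∷ e₁) + Φ P′
                ≤⟨ +-mono-≤ (≤-trans (*-monoˡ-≤ (suc (weight (z ∷ e₁))) (g≤1 (fromList (z ∷ e₁)))) (≤-reflexive (*-identityˡ _))) ΦP′ ⟩
              suc (weight (z ∷ e₁)) + Φ L₂ <⟨ +-monoˡ-< (Φ L₂) (s≤s (+-monoˡ-< (weight e₁) dz<dx)) ⟩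
              suc (weight (x ∷ e₁)) + Φ L₂ ≡⟨ cong (λ t → suc t + Φ L₂) (∑-↭ deg e↭) ⟨
              suc (weight e) + Φ L₂        ≤⟨ +-mono-≤ penalty-e (m≤n+m (Φ L₂) (penalty E₀)) ⟩
              penalty e + Φ (E₀ ∷ L₂)      ≡⟨ cong (_+_ (penalty e)) (∑-↭ penalty L↭) ⟨
              penalty e + Φ L              ≡⟨ ΦP ⟨
              Φ P                          ∎)
          where open ≤-Reasoning

    repartition : ∀ {Z} P → length P ≡ suc (suc m) → All Block P → Z ++ concat P ↭ V → All Light (concat P) →
                  ∃ λ P′ → length P′ ≡ suc (suc m) × All Good P′ × concat P′ ↭ concat P
    repartition {Z} P = go (Φ P) P ≤-refl
      where
      go : ∀ fuel P → Φ P ≤ fuel → length P ≡ suc (suc m) → All Block P → Z ++ concat P ↭ V → All Light (concat P) →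
           ∃ λ P′ → length P′ ≡ suc (suc m) × All Good P′ × concat P′ ↭ concat P
      go zero P Φ≤ lP bP pV light = P , lP , good-Φ P bP (n≤0⇒n≡0 Φ≤) , ↭-refl
      go (suc fuel) P Φ≤ lP bP pV light with Φ P ≟ 0
      ... | yes Φ≡0 = P , lP , good-Φ P bP Φ≡0 , ↭-refl
      ... | no Φ≢0 =
        let P′ , lP′ , bP′ , p′ , Φ< = improve {Z} P lP bP pV light (n≢0⇒n>0 Φ≢0)
            P″ , lP″ , gP″ , p″ = go fuel P′ (≤-pred (≤-trans Φ< Φ≤)) lP′ bP′ (↭-trans (++⁺ˡ Z p′) pV) (All-resp-↭ (↭-sym p′) light)
        in P″ , lP″ , gP″ , ↭-trans p″ p′

-- Heavy vertices and their greedy cover.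

filter-split : ∀ {P : A → Set} (P? : ∀ x → Dec (P x)) xs → filter P? xs ++ filter (¬? ∘ P?) xs ↭ xs
filter-split P? []       = ↭-refl
filter-split P? (x ∷ xs) with P? x
... | yes _ = prep x (filter-split P? xs)
... | no  _ = ↭-trans (shift x (filter P? xs) (filter (¬? ∘ P?) xs)) (prep x (filter-split P? xs))

take-drop-↭ : ∀ m (xs : List A) → take m xs ++ drop m xs ↭ xs
take-drop-↭ m xs = ↭-reflexive (take++drop≡id m xs)

All-drop-++ : ∀ {P : A → Set} m xs {ys} → length xs ≤ m → All P ys → All P (drop m (xs ++ ys))
All-drop-++ m       []       _       ps = All.drop⁺ m ps
All-drop-++ (suc m) (x ∷ xs) (s≤s l) ps = All-drop-++ m xs l ps

-- f marks a family of (b + 2)-sets and g its complement.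
module Cover {n : ℕ} (b N : ℕ) (V : List (Fin n)) (lV : length V ≡ suc N) (V-full : ∀ x → x ∈ V)
             (f g : Subset n → ℕ) (f+g≤1 : ∀ p → f p + g p ≤ 1)
             (f-van : VanishesBelow (suc (suc b)) f) (g-van : VanishesBelow (suc (suc b)) g) where

  f≤1 : ∀ p → f p ≤ 1
  f≤1 p = ≤-trans (m≤m+n (f p) (g p)) (f+g≤1 p)

  g≤1 : ∀ p → g p ≤ 1
  g≤1 p = ≤-trans (m≤n+m (g p) (f p)) (f+g≤1 p)

  k c c₂ : ℕ
  k = suc (suc b)
  c = N C suc b
  c₂ = N C b

  fdeg gdeg : Fin n → ℕ
  fdeg x = S (suc b) V (f ∘ ins x)
  gdeg x = S (suc b) V (g ∘ ins x)

  -- Terms that insert x twice vanish, so x may be deleted from `V`, which leaves N vertices from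
  -- which the other k - 1 are chosen.
  fdeg+gdeg≤c : ∀ x → fdeg x + gdeg x ≤ c
  fdeg+gdeg≤c x with _ , V′ , V↭ , refl ← Any⇒↭ (V-full x) = begin
    fdeg x + gdeg x                  ≡⟨ S-+ (suc b) V (f ∘ ins x) (g ∘ ins x) ⟨
    S (suc b) V (h ∘ ins x)          ≡⟨ S-↭ (suc b) (h ∘ ins x) V↭ ⟩
    S (suc b) V′ (h ∘ ins x) + S b V′ (h ∘ ins x ∘ ins x)
      ≡⟨ cong (_+_ (S (suc b) V′ (h ∘ ins x))) (S-vanish-ins² b V′ h x (λ A l → cong₂ _+_ (f-van A l) (g-van A l))) ⟩
    S (suc b) V′ (h ∘ ins x) + 0     ≡⟨ +-identityʳ _ ⟩
    S (suc b) V′ (h ∘ ins x)         ≤⟨ S-≤-C (suc b) V′ (f+g≤1 ∘ ins x) ⟩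
    length V′ C suc b                ≡⟨ cong (_C suc b) (suc-injective (≡.trans (sym (↭-length V↭)) lV)) ⟩
    c                                ∎
    where
    open ≤-Reasoning
    h : Subset n → ℕ
    h p = f p + g p

  Heavy : Fin n → Set
  Heavy x = c ≤ 2 * gdeg x

  heavy? : ∀ x → Dec (Heavy x)
  heavy? x = c ≤? 2 * gdeg x

  heavy light : List (Fin n) → List (Fin n)
  heavy = filter heavy?
  light = filter (¬? ∘ heavy?)

  all-heavy : ∀ L → All Heavy (heavy L)
  all-heavy = All.all-filter heavy?

  heavy-fdeg : ∀ {x} → Heavy x → 2 * fdeg x ≤ c
  heavy-fdeg {x} hx = +-cancelʳ-≤ c _ _ (begin
    2 * fdeg x + c                ≤⟨ +-monoʳ-≤ (2 * fdeg x) hx ⟩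
    2 * fdeg x + 2 * gdeg x       ≡⟨ *-distribˡ-+ 2 (fdeg x) (gdeg x) ⟨
    2 * (fdeg x + gdeg x)         ≤⟨ *-monoʳ-≤ 2 (fdeg+gdeg≤c x) ⟩
    2 * c                         ≡⟨ cong (_+_ c) (+-identityʳ c) ⟩
    c + c                         ∎)
    where open ≤-Reasoning

  #heavy : List (Fin n) → ℕ
  #heavy L = length (heavy L)

  #heavy-++ : ∀ K L → #heavy (K ++ L) ≡ #heavy K + #heavy L
  #heavy-++ K L = ≡.trans (cong length (filter-++ heavy? K L)) (length-++ (heavy K))

  #heavy-↭ : ∀ {K L} → K ↭ L → #heavy K ≡ #heavy L
  #heavy-↭ p = ↭-length (filter-↭ heavy? p)

  -- By `absorption`, (b + 1) c = (N - b) c₂. This is how error terms, which count sets through two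
  -- given vertices, are absorbed into multiples of c.
  c₂-≤-c : ∀ x → x * suc b + b ≤ N → x * c₂ ≤ c
  c₂-≤-c x l = *-cancelˡ-≤ (suc b) (+-cancelʳ-≤ (b * c₂) _ _ (begin
    suc b * (x * c₂) + b * c₂    ≡⟨ arith b x c₂ ⟩
    (x * suc b + b) * c₂         ≤⟨ *-monoˡ-≤ c₂ l ⟩
    N * c₂                       ≡⟨ absorption N b ⟨
    suc b * c + b * c₂           ∎))
    where
    open ≤-Reasoning
    arith : ∀ b x c → suc b * (x * c) + b * c ≡ (x * suc b + b) * c
    arith = solve-∀

  -- The g-degrees of 3R heavy vertices would add up to at least 3Rc/2. By the union bound they add
  -- up to less than Rc + (3R)² c₂, and 18 R c₂ ≤ c makes the second term at most Rc/2.
  few-heavy : ∀ R → S (suc (suc b)) V g < R * c → 18 * R * suc b + b ≤ N → #heavy V < 3 * R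
  few-heavy R Sg< l with 3 * R ≤? #heavy V
  ... | no ¬p = ≰⇒> ¬p
  ... | yes 3R≤ = contradiction (begin-strict
    3 * R * c
      ≡⟨ cong (_* c) lQ ⟨
    length Q * c
      ≡⟨ ∑-const c Q ⟨
    ∑ (λ _ → c) Q
      ≤⟨ ∑-mono-All (All.take⁺ (3 * R) (all-heavy V)) ⟩
    ∑ (λ x → 2 * gdeg x) Q
      ≡⟨ ∑-* 2 gdeg Q ⟩
    2 * ∑ gdeg Q
      ≤⟨ *-monoʳ-≤ 2 (S-union b Q X g g≤1 V↭ (≤-reflexive lV)) ⟩
    2 * (S k (Q ++ X) g + length Q * (length Q * c₂))
      ≡⟨ cong₂ (λ s q → 2 * (s + q * (q * c₂))) (S-↭ k g (↭-sym V↭)) lQ ⟩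
    2 * (S k V g + 3 * R * (3 * R * c₂))
      <⟨ *-monoʳ-< 2 (+-monoˡ-< _ Sg<) ⟩
    2 * (R * c + 3 * R * (3 * R * c₂))
      ≡⟨ arith R c c₂ ⟩
    2 * (R * c) + R * (18 * R * c₂)
      ≤⟨ +-monoʳ-≤ (2 * (R * c)) (*-monoʳ-≤ R (c₂-≤-c (18 * R) l)) ⟩
    2 * (R * c) + R * c
      ≡⟨ arith′ R c ⟩
    3 * R * c ∎) (<-irrefl refl)
    where
    open ≤-Reasoning
    Q = take (3 * R) (heavy V)
    X = drop (3 * R) (heavy V) ++ light V
    lQ : length Q ≡ 3 * R
    lQ = ≡.trans (length-take (3 * R) (heavy V)) (m≤n⇒m⊓n≡m 3R≤)
    V↭ : V ↭ Q ++ X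
    V↭ = ↭-sym (↭-trans (↭-reflexive (sym (++-assoc Q (drop (3 * R) (heavy V)) (light V))))
      (↭-trans (++⁺ʳ (light V) (take-drop-↭ (3 * R) (heavy V))) (filter-split heavy? V)))
    arith : ∀ R c c₂ → 2 * (R * c + 3 * R * (3 * R * c₂)) ≡ 2 * (R * c) + R * (18 * R * c₂)
    arith = solve-∀
    arith′ : ∀ R c → 2 * (R * c) + R * c ≡ 3 * R * c
    arith′ = solve-∀

  Edge : List (Fin n) → Set
  Edge B = length B ≡ k × 0 < f (fromList B)

  length-concat : ∀ {M} → All Edge M → length (concat M) ≡ length M * k
  length-concat []                      = refl
  length-concat (_∷_ {B} (lB , _) edges) = ≡.trans (length-++ B) (cong₂ _+_ lB (length-concat edges))

  -- At most |W| c₂ of the edges through v meet W, so an `fdeg v` above this bound leaves an edge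
  -- that avoids W.
  edge-through : ∀ v W L → W ++ (v ∷ L) ↭ V → length W * c₂ < fdeg v →
                 ∃₂ λ A L′ → L ↭ A ++ L′ × Edge (v ∷ A)
  edge-through v W L p <fdeg =
    let A , L′ , q , lA , fA = S-witness (suc b) L (f ∘ ins v) (+-cancelʳ-< (length W * c₂) _ _ fdeg-bound) in
    A , L′ , q , cong suc lA , fA
    where
    open ≤-Reasoning
    s = S (suc b) L (f ∘ ins v)
    fdeg-bound : 0 + length W * c₂ < s + length W * c₂
    fdeg-bound = begin-strict
      length W * c₂
        <⟨ <fdeg ⟩
      fdeg v
        ≡⟨ S-↭ (suc b) (f ∘ ins v) p ⟨
      S (suc b) (W ++ (v ∷ L)) (f ∘ ins v)
        ≤⟨ S-truncate b W (v ∷ L) (f≤1 ∘ ins v) (≤-reflexive (≡.trans (↭-length p) lV)) ⟩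
      s + S b L (f ∘ ins v ∘ ins v) + length W * c₂
        ≡⟨ cong (λ t → s + t + length W * c₂) (S-vanish-ins² b L f v f-van) ⟩
      s + 0 + length W * c₂
        ≡⟨ cong (_+ length W * c₂) (+-identityʳ s) ⟩
      s + length W * c₂ ∎

  -- Let ℓ be the number of light vertices, so that N₀ = m + ℓ. At most C(ℓ, k) edges avoid all
  -- heavy vertices, while there are more than C(m + ℓ, k) ≥ C(ℓ, k) + m C(ℓ, k - 1) edges. Hence
  -- the f-degrees of the heavy vertices exceed m C(ℓ, k - 1) in total, and C(ℓ, k - 1) ≥ c - q c₂
  -- for q heavy vertices. The factor 2 matches `heavy-fdeg`.
  fdeg-heavy-large : ∀ {m R} → m + R ≡ #heavy V → ∀ {N₀} → N₀ + R ≡ suc N → N₀ C k < S k V f →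
                     2 * (m * c) < 2 * ∑ fdeg (heavy V) + 2 * (m * (#heavy V * c₂))
  fdeg-heavy-large {m} {R} m+R {N₀} N₀+R <Sf = begin-strict
    2 * (m * c)
      ≤⟨ *-monoʳ-≤ 2 (*-monoʳ-≤ m c≤) ⟩
    2 * (m * (ℓ C suc b + q * c₂))
      ≡⟨ arith m (ℓ C suc b) (q * c₂) ⟩
    2 * (m * (ℓ C suc b)) + 2 * (m * (q * c₂))
      <⟨ +-monoˡ-< (2 * (m * (q * c₂))) (*-monoʳ-< 2 (+-cancelˡ-< (ℓ C k) _ _ step)) ⟩
    2 * ∑ fdeg (heavy V) + 2 * (m * (q * c₂)) ∎
    where
    open ≤-Reasoning
    q = #heavy V
    ℓ = length (light V)
    q+ℓ : q + ℓ ≡ suc N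
    q+ℓ = ≡.trans (sym (length-++ (heavy V))) (≡.trans (↭-length (filter-split heavy? V)) lV)
    N₀≡ : N₀ ≡ m + ℓ
    N₀≡ = +-cancelʳ-≡ R _ _ (≡.trans N₀+R (≡.trans (sym q+ℓ) (≡.trans (cong (_+ ℓ) (sym m+R)) (arith m R ℓ))))
      where
      arith : ∀ m R l → m + R + l ≡ m + l + R
      arith = solve-∀
    c≤ : c ≤ ℓ C suc b + q * c₂
    c≤ = ≤-trans (C-monoˡ-≤ (suc b) (≤-trans (n≤1+n N) (≤-reflexive (sym q+ℓ))))
                 (C-telescope-≤ q b (≤-reflexive q+ℓ))
    step : ℓ C k + m * (ℓ C suc b) < ℓ C k + ∑ fdeg (heavy V)
    step = begin-strict
      ℓ C k + m * (ℓ C suc b)                 ≤⟨ C-telescope-≥ m ℓ (suc b) ⟩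
      (m + ℓ) C k                             ≡⟨ cong (_C k) N₀≡ ⟨
      N₀ C k                                  <⟨ <Sf ⟩
      S k V f                                 ≡⟨ S-↭ k f (filter-split heavy? V) ⟨
      S k (heavy V ++ light V) f
        ≤⟨ S-split (suc b) (heavy V) (light V) f (filter-split heavy? V) ⟩
      S k (light V) f + ∑ fdeg (heavy V)      ≤⟨ +-monoˡ-≤ _ (S-≤-C k (light V) f≤1) ⟩
      ℓ C k + ∑ fdeg (heavy V)                ∎
    arith : ∀ m a b → 2 * (m * (a + b)) ≡ 2 * (m * a) + 2 * (m * b)
    arith = solve-∀

  ∑fdeg-heavy : ∀ L → 2 * ∑ fdeg (heavy L) ≤ #heavy L * c
  ∑fdeg-heavy L = ≤-trans (≤-reflexive (sym (∑-* 2 fdeg (heavy L))))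
                          (∑-≤-const (All.map heavy-fdeg (all-heavy L)))

  #heavy-∷ : ∀ v A → Heavy v → 0 < #heavy (v ∷ A)
  #heavy-∷ v A hv = filter-some heavy? {v ∷ A} (here hv)

  module Greedy (m R N₀ : ℕ) (m+R : m + R ≡ #heavy V) (N₀+R : N₀ + R ≡ suc N) (0<R : 0 < R)
                (<Sf : N₀ C k < S k V f) (N-large : 2 * #heavy V * suc k * suc b + b ≤ N) where

    -- If every heavy vertex v outside W were only on edges meeting W, the degrees
    -- of the heavy vertices would be too small for f to exceed N₀ C k.
    ¬heavy-fdegs-small : ∀ W L → W ++ L ↭ V → length W ≤ #heavy W * k → R ≤ #heavy L →
                            ¬ All (λ x → fdeg x ≤ length W * c₂) (heavy L)
    ¬heavy-fdegs-small W L p lW R≤ small = <-irrefl refl (begin-strict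
      2 * (m * c)
        <⟨ fdeg-heavy-large {m} {R} m+R {N₀} N₀+R <Sf ⟩
      2 * ∑ fdeg (heavy V) + 2 * (m * (q * c₂))
        ≡⟨ cong (λ s → 2 * s + 2 * (m * (q * c₂))) split ⟩
      2 * (∑ fdeg (heavy W) + ∑ fdeg (heavy L)) + 2 * (m * (q * c₂))
        ≡⟨ cong (_+ 2 * (m * (q * c₂))) (*-distribˡ-+ 2 (∑ fdeg (heavy W)) _) ⟩
      2 * ∑ fdeg (heavy W) + 2 * ∑ fdeg (heavy L) + 2 * (m * (q * c₂))
        -- At most m heavy vertices lie in W, each of f-degree at most c/2. They account for only
        -- half of 2 m c; all other terms are multiples of c₂.
        ≤⟨ +-monoˡ-≤ _ (+-mono-≤ (≤-trans (∑fdeg-heavy W) (*-monoˡ-≤ c w≤m)) (*-monoʳ-≤ 2 (∑-≤-const small))) ⟩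
      m * c + 2 * (#heavy L * (length W * c₂)) + 2 * (m * (q * c₂))
        ≤⟨ +-monoˡ-≤ _ (+-monoʳ-≤ (m * c) (*-monoʳ-≤ 2 (*-mono-≤ L≤q (*-monoˡ-≤ c₂ (≤-trans lW (*-monoˡ-≤ k w≤m)))))) ⟩
      m * c + 2 * (q * (m * k * c₂)) + 2 * (m * (q * c₂))
        ≡⟨ arith m c q k c₂ ⟩
      m * c + m * (2 * q * suc k * c₂)
        ≤⟨ +-monoʳ-≤ (m * c) (*-monoʳ-≤ m (c₂-≤-c (2 * q * suc k) N-large)) ⟩
      m * c + m * c
        ≡⟨ cong (_+_ (m * c)) (+-identityʳ (m * c)) ⟨
      2 * (m * c) ∎)
      where
      open ≤-Reasoning
      q = #heavy V
      w+L : #heavy W + #heavy L ≡ q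
      w+L = ≡.trans (sym (#heavy-++ W L)) (#heavy-↭ p)
      L≤q : #heavy L ≤ q
      L≤q = ≤-trans (m≤n+m _ _) (≤-reflexive w+L)
      w≤m : #heavy W ≤ m
      w≤m = +-cancelʳ-≤ R _ _ (≤-trans (+-monoʳ-≤ (#heavy W) R≤) (≤-reflexive (≡.trans w+L (sym m+R))))
      split : ∑ fdeg (heavy V) ≡ ∑ fdeg (heavy W) + ∑ fdeg (heavy L)
      split = ≡.trans (sym (∑-↭ fdeg (filter-↭ heavy? p)))
        (≡.trans (cong (∑ fdeg) (filter-++ heavy? W L)) (∑-++ fdeg (heavy W) (heavy L)))
      arith : ∀ m c q k c₂ → m * c + 2 * (q * (m * k * c₂)) + 2 * (m * (q * c₂)) ≡ m * c + m * (2 * q * suc k * c₂)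
      arith = solve-∀

    next-edge : ∀ W L → W ++ L ↭ V → length W ≤ #heavy W * k → R ≤ #heavy L →
                ∃₂ λ B L′ → L ↭ B ++ L′ × Edge B × 0 < #heavy B
    next-edge W L p lW R≤ with any? (λ x → length W * c₂ <? fdeg x) (heavy L)
    ... | no ¬any = contradiction (All.map ≮⇒≥ (All.¬Any⇒All¬ (heavy L) ¬any)) (¬heavy-fdegs-small W L p lW R≤)
    ... | yes any =
      let v , Hs , H↭ , v< = Any⇒↭ any
          L↭ = ↭-trans (↭-sym (filter-split heavy? L)) (++⁺ʳ (light L) H↭)
          A , L′ , q , edge = edge-through v W (Hs ++ light L) (↭-trans (++⁺ˡ W (↭-sym L↭)) p) v<
      in v ∷ A , L′ , ↭-trans L↭ (prep v q) , edge , #heavy-∷ v A (All.head (All-resp-↭ H↭ (all-heavy L)))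

    -- Every chosen edge contains a heavy vertex not covered before. So the number of uncovered
    -- heavy vertices serves as fuel, and the edges chosen never outnumber the heavy vertices
    -- covered, which gives the bound on W that `next-edge` requires.
    cover : ∃₂ λ M L → concat M ++ L ↭ V × All Edge M × length M ≤ #heavy V × #heavy L < R
    cover = go (#heavy V) [] V ≤-refl ↭-refl [] z≤n
      where
      go : ∀ fuel M L → #heavy L ≤ fuel → concat M ++ L ↭ V → All Edge M → length M ≤ #heavy (concat M) →
           ∃₂ λ M L → concat M ++ L ↭ V × All Edge M × length M ≤ #heavy V × #heavy L < R
      go fuel M L L≤ p edges lM with R ≤? #heavy L
      ... | no R≰ = M , L , p , edges ,
        ≤-trans lM (≤-trans (m≤m+n _ (#heavy L)) (≤-reflexive (≡.trans (sym (#heavy-++ (concat M) L)) (#heavy-↭ p)))) , ≰⇒> R≰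
      go zero       M L L≤ p edges lM | yes R≤ = contradiction (≤-trans 0<R (≤-trans R≤ L≤)) λ ()
      go (suc fuel) M L L≤ p edges lM | yes R≤ =
        let B , L′ , q , edge , 0<B = next-edge (concat M) L p
              (≤-trans (≤-reflexive (length-concat edges)) (*-monoˡ-≤ k lM)) R≤
            L≡ = ≡.trans (#heavy-↭ q) (#heavy-++ B L′)
        in go fuel (B ∷ M) L′
             (≤-pred (≤-trans (+-monoˡ-≤ (#heavy L′) 0<B) (≤-trans (≤-reflexive (sym L≡)) L≤)))
             (↭-trans (↭-reflexive (++-assoc B (concat M) L′)) (↭-trans (shifts B (concat M)) (↭-trans (++⁺ˡ (concat M) (↭-sym q)) p)))
             (edge ∷ edges)
             (≤-trans (+-mono-≤ 0<B lM) (≤-reflexive (sym (#heavy-++ B (concat M)))))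

-- Numerical estimates.

m≤n⇒∃[o]o+m≡n : ∀ {m n} → m ≤ n → ∃[ o ] o + m ≡ n
m≤n⇒∃[o]o+m≡n {m} {n} m≤n = n ∸ m , m∸n+n≡m m≤n

C-suc : ∀ x t → suc t * ((x + t) C suc t) ≡ x * ((x + t) C t)
C-suc x t = +-cancelʳ-≡ (t * ((x + t) C t)) _ _ (≡.trans (absorption (x + t) t) (*-distribʳ-+ ((x + t) C t) x t))

transversals-suc : ∀ k y t → suc t * (k ^ suc t * ((y + t) C suc t)) ≡ k * y * (k ^ t * ((y + t) C t))
transversals-suc k y t = begin
  suc t * (k * k ^ t * ((y + t) C suc t))    ≡⟨ arith₁ (suc t) k (k ^ t) ((y + t) C suc t) ⟩
  k * k ^ t * (suc t * ((y + t) C suc t))    ≡⟨ cong (_*_ (k * k ^ t)) (C-suc y t) ⟩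
  k * k ^ t * (y * ((y + t) C t))            ≡⟨ arith₂ k (k ^ t) y ((y + t) C t) ⟩
  k * y * (k ^ t * ((y + t) C t))            ∎
  where
  open ≡-Reasoning
  arith₁ : ∀ t k x c → t * (k * x * c) ≡ k * x * (t * c)
  arith₁ = solve-∀
  arith₂ : ∀ k x y c → k * x * (y * c) ≡ k * y * (x * c)
  arith₂ = solve-∀

k*y≤x : ∀ {k x y} t → 0 < k → k * (y + t) ≤ x + t → k * y ≤ x
k*y≤x {k} {x} {y} t 0<k p = +-cancelʳ-≤ t _ _ (begin
  k * y + t       ≤⟨ +-monoʳ-≤ (k * y) (≤-trans (≤-reflexive (sym (*-identityˡ t))) (*-monoˡ-≤ t 0<k)) ⟩
  k * y + k * t   ≡⟨ *-distribˡ-+ k y t ⟨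
  k * (y + t)     ≤⟨ p ⟩
  x + t           ∎)
  where open ≤-Reasoning

-- Both sides are products of t factors over t!, and k (m - i) ≤ N - i for each factor.
transversals-≤-C : ∀ {k m N} t → 0 < k → k * m ≤ N → t ≤ m → t ≤ N → k ^ t * (m C t) ≤ N C t
transversals-≤-C zero    _   _ _ _ = ≤-refl
transversals-≤-C {k} {m} {N} (suc t) 0<k km≤N t<m t<N
  with y , refl ← m≤n⇒∃[o]o+m≡n (<⇒≤ t<m) | x , refl ← m≤n⇒∃[o]o+m≡n (<⇒≤ t<N) =
  *-cancelˡ-≤ (suc t) (begin
    suc t * (k ^ suc t * ((y + t) C suc t))   ≡⟨ transversals-suc k y t ⟩
    k * y * (k ^ t * ((y + t) C t))
      ≤⟨ *-mono-≤ (k*y≤x t 0<k km≤N) (transversals-≤-C t 0<k km≤N (<⇒≤ t<m) (<⇒≤ t<N)) ⟩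
    x * ((x + t) C t)                         ≡⟨ C-suc x t ⟨
    suc t * ((x + t) C suc t)                 ∎)
  where open ≤-Reasoning

-- Bernoulli's inequality: k ^ t * (m C t) ≥ (1 − t Δ / A) (N C t), since each of
-- the t factors k (m − i) / (N − i) is at least 1 − Δ / A.
transversals-≥ : ∀ {A Δ k m N} t → 0 < k → k * m ≤ N → t ≤ m → A + t ≤ N → N + k * t ≤ k * m + Δ →
                 A * (N C t) ≤ A * (k ^ t * (m C t)) + t * Δ * (N C t)
transversals-≥ zero _ _ _ _ _ = m≤m+n _ _
transversals-≥ {A} {Δ} {k} {m} {N} (suc t) 0<k km≤N t<m At≤N N≤
  with y , refl ← m≤n⇒∃[o]o+m≡n (<⇒≤ t<m) | x , refl ← m≤n⇒∃[o]o+m≡n (≤-trans (n≤1+n t) (≤-trans (m≤n+m (suc t) A) At≤N)) =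
  *-cancelˡ-≤ (suc t) (begin
    suc t * (A * c′)
      ≡⟨ swap* (suc t) A c′ ⟩
    A * (suc t * c′)
      ≡⟨ cong (_*_ A) (C-suc x t) ⟩
    A * (x * c)
      ≡⟨ swap* A x c ⟩
    x * (A * c)
      ≤⟨ *-monoʳ-≤ x IH ⟩
    x * (A * K + t * Δ * c)
      ≡⟨ arith₁ x A K (t * Δ) c ⟩
    x * (A * K) + t * Δ * (x * c)
      ≤⟨ +-monoˡ-≤ _ (*-monoˡ-≤ (A * K) x≤) ⟩
    (k * y + Δ) * (A * K) + t * Δ * (x * c)
      ≡⟨ arith₂ (k * y) Δ A K (t * Δ * (x * c)) ⟩
    A * (k * y * K) + Δ * (A * K) + t * Δ * (x * c)
      ≤⟨ +-monoˡ-≤ _ (+-monoʳ-≤ (A * (k * y * K)) (*-monoʳ-≤ Δ (*-mono-≤ A≤x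
           (transversals-≤-C t 0<k km≤N (<⇒≤ t<m) (m≤n+m t x))))) ⟩
    A * (k * y * K) + Δ * (x * c) + t * Δ * (x * c)
      ≡⟨ cong₂ (λ u v → A * u + Δ * v + t * Δ * v) (transversals-suc k y t) (C-suc x t) ⟨
    A * (suc t * K′) + Δ * (suc t * c′) + t * Δ * (suc t * c′)
      ≡⟨ arith₃ A (suc t) K′ Δ c′ t ⟩
    suc t * (A * K′ + suc t * Δ * c′) ∎)
  where
  open ≤-Reasoning
  c = (x + t) C t
  c′ = (x + t) C suc t
  K = k ^ t * ((y + t) C t)
  K′ = k ^ suc t * ((y + t) C suc t)
  At≤ : A + t ≤ x + t
  At≤ = ≤-trans (+-monoʳ-≤ A (n≤1+n t)) At≤N
  A≤x : A ≤ x
  A≤x = +-cancelʳ-≤ t _ _ At≤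
  N≤t : (x + t) + k * t ≤ k * (y + t) + Δ
  N≤t = ≤-trans (+-monoʳ-≤ (x + t) (*-monoʳ-≤ k (n≤1+n t))) N≤
  x≤ : x ≤ k * y + Δ
  x≤ = +-cancelʳ-≤ (k * t) _ _ (begin
    x + k * t               ≤⟨ +-monoˡ-≤ (k * t) (m≤m+n x t) ⟩
    x + t + k * t           ≤⟨ N≤t ⟩
    k * (y + t) + Δ         ≡⟨ arith k y t Δ ⟩
    k * y + Δ + k * t       ∎)
    where
    arith : ∀ k y t Δ → k * (y + t) + Δ ≡ k * y + Δ + k * t
    arith = solve-∀
  IH : A * c ≤ A * K + t * Δ * c
  IH = transversals-≥ t 0<k km≤N (<⇒≤ t<m) At≤ N≤t
  swap* : ∀ a b c → a * (b * c) ≡ b * (a * c)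
  swap* = solve-∀
  arith₁ : ∀ x A K d c → x * (A * K + d * c) ≡ x * (A * K) + d * (x * c)
  arith₁ = solve-∀
  arith₂ : ∀ u Δ A K w → (u + Δ) * (A * K) + w ≡ A * (u * K) + Δ * (A * K) + w
  arith₂ = solve-∀
  arith₃ : ∀ A s K Δ c t → A * (s * K) + Δ * (s * c) + t * Δ * (s * c) ≡ s * (A * K + suc t * Δ * c)
  arith₃ = solve-∀

-- The numerical hypotheses, with k = b + 2 and n = N + 1.  All that is used of
-- them is s ≥ 16 k r + 20 k².
module Numbers (b r s N : ℕ) (key : 16 * (2 + b) * r + 20 * ((2 + b) * (2 + b)) ≤ s)
               (N-def : suc N ≡ (s + 1) * (2 + b) + r) where

  private
    k = 2 + b

  N≡ : N ≡ s * k + (1 + b) + r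
  N≡ = suc-injective (≡.trans N-def (arith s b r))
    where
    arith : ∀ s b r → (s + 1) * (2 + b) + r ≡ suc (s * (2 + b) + (1 + b) + r)
    arith = solve-∀

  -- This turns a bound by s into the hypothesis of `c₂-≤-c`.
  *-suc-b : ∀ {x} → x ≤ s → x * suc b + b ≤ N
  *-suc-b {x} x≤s = begin
    x * suc b + b               ≤⟨ +-mono-≤ (*-monoˡ-≤ (suc b) x≤s) (n≤1+n b) ⟩
    s * suc b + (1 + b)         ≤⟨ +-monoˡ-≤ (1 + b) (*-monoʳ-≤ s (n≤1+n (suc b))) ⟩
    s * k + (1 + b)             ≤⟨ m≤m+n _ r ⟩
    s * k + (1 + b) + r         ≡⟨ N≡ ⟨
    N                           ∎
    where open ≤-Reasoning

  18R≤ : 18 * suc r * suc b + b ≤ N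
  -- The added polynomial is the exact difference between the left side of `key` and 18 (r + 1),
  -- which leaves an identity for the ring solver. The same device is used below.
  18R≤ = *-suc-b (≤-trans (m≤m+n (18 * suc r) (14 * r + 16 * b * r + 20 * b * b + 80 * b + 62)) (≤-trans (≤-reflexive (arith b r)) key))
    where
    arith : ∀ b r → 18 * suc r + (14 * r + 16 * b * r + 20 * b * b + 80 * b + 62) ≡
            16 * (2 + b) * r + 20 * ((2 + b) * (2 + b))
    arith = solve-∀

  2q≤ : ∀ {q} → q ≤ 3 * r + 2 → 2 * q * suc (2 + b) * suc b + b ≤ N
  2q≤ {q} q≤ = *-suc-b (≤-trans (*-monoˡ-≤ (3 + b) (*-monoʳ-≤ 2 q≤))
    (≤-trans (m≤m+n _ (14 * r + 10 * b * r + 20 * b * b + 76 * b + 68)) (≤-trans (≤-reflexive (arith b r)) key)))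
    where
    arith : ∀ b r → 2 * (3 * r + 2) * (3 + b) + (14 * r + 10 * b * r + 20 * b * b + 76 * b + 68) ≡
            16 * (2 + b) * r + 20 * ((2 + b) * (2 + b))
    arith = solve-∀

  module _ {j : ℕ} (j≤ : j ≤ 3 * r + 2) where

    8kR+j≤ : 8 * (k * suc r) + j ≤ s
    8kR+j≤ = ≤-trans (+-monoʳ-≤ (8 * (k * suc r)) j≤)
      (≤-trans (m≤m+n _ (8 * b * r + 13 * r + 20 * b * b + 72 * b + 62)) (≤-trans (≤-reflexive (arith b r)) key))
      where
      arith : ∀ b r → 8 * ((2 + b) * suc r) + (3 * r + 2) + (8 * b * r + 13 * r + 20 * b * b + 72 * b + 62) ≡
              16 * (2 + b) * r + 20 * ((2 + b) * (2 + b))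
      arith = solve-∀

    -- The error in the Bernoulli estimate: k (j + 2) for the j blocks of the cover and the two
    -- blocks set aside by an exchange, r for the discarded vertices, and k² as a bound for k (k -
    -- 1).
    Δ : ℕ
    Δ = k * (j + 2) + r + k * k

    4Δ≤ : 4 * Δ ≤ s
    4Δ≤ = ≤-trans (*-monoʳ-≤ 4 (+-monoˡ-≤ (k * k) (+-monoˡ-≤ r (*-monoʳ-≤ k (+-monoˡ-≤ 2 j≤)))))
      (≤-trans (m≤m+n _ (4 * b * r + 4 * r + 16 * b * b + 48 * b + 32)) (≤-trans (≤-reflexive (arith b r)) key))
      where
      arith : ∀ b r → 4 * ((2 + b) * (3 * r + 2 + 2) + r + (2 + b) * (2 + b)) + (4 * b * r + 4 * r + 16 * b * b + 48 * b + 32) ≡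
              16 * (2 + b) * r + 20 * ((2 + b) * (2 + b))
      arith = solve-∀

    module _ {m : ℕ} (m+j : suc m + j ≡ s) where

      8kR≤ : 8 * (k * suc r) ≤ suc m
      8kR≤ = +-cancelʳ-≤ j _ _ (≤-trans 8kR+j≤ (≤-reflexive (sym m+j)))

      -- In `transversals-≥` take A = s k and t = k - 1. The relative loss t Δ / A is then at most
      -- 1/4, because 4 Δ ≤ s.
      many-transversals : 3 * (N C suc b) ≤ 4 * (k ^ suc b * (m C suc b))
      many-transversals = *-cancelˡ-≤ (s * k) {{>-nonZero 0<sk}} (+-cancelʳ-≤ (s * k * c) _ _ (begin
        s * k * (3 * c) + s * k * c
          ≡⟨ arith₁ (s * k) c ⟩
        4 * (s * k * c)
          ≤⟨ *-monoʳ-≤ 4 (transversals-≥ (suc b) (s≤s z≤n) km≤N b<m A≤ N≤) ⟩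
        4 * (s * k * K + suc b * Δ * c)
          ≡⟨ arith₂ (s * k) K (suc b) Δ c ⟩
        s * k * (4 * K) + 4 * Δ * suc b * c
          ≤⟨ +-monoʳ-≤ (s * k * (4 * K)) (*-monoˡ-≤ c (*-mono-≤ 4Δ≤ (n≤1+n (suc b)))) ⟩
        s * k * (4 * K) + s * k * c ∎))
        where
        open ≤-Reasoning
        c = N C suc b
        K = k ^ suc b * (m C suc b)
        arith₁ : ∀ a c → a * (3 * c) + a * c ≡ 4 * (a * c)
        arith₁ = solve-∀
        arith₂ : ∀ a K t Δ c → 4 * (a * K + t * Δ * c) ≡ a * (4 * K) + 4 * Δ * t * c
        arith₂ = solve-∀
        N≡′ : N ≡ k * m + k * (j + 2) + r ∸ 1
        N≡′ = cong (_∸ 1) (≡.trans N-def (≡.trans (cong (λ t → (t + 1) * k + r) (sym m+j)) (arith m j b r)))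
          where
          arith : ∀ m j b r → (suc m + j + 1) * (2 + b) + r ≡ (2 + b) * m + (2 + b) * (j + 2) + r
          arith = solve-∀
        0<sk : 0 < s * k
        0<sk = *-mono-≤ (≤-trans (s≤s z≤n) (≤-reflexive m+j)) (s≤s z≤n)
        km≤N : k * m ≤ N
        km≤N = ≤-trans (m≤m+n (k * m) (k * suc j + (1 + b) + r)) (≤-reflexive (≡.trans (arith m j b r)
                 (≡.trans (cong (λ t → t * k + (1 + b) + r) m+j) (sym N≡))))
          where
          arith : ∀ m j b r → (2 + b) * m + ((2 + b) * suc j + (1 + b) + r) ≡ (suc m + j) * (2 + b) + (1 + b) + r
          arith = solve-∀
        b<m : suc b ≤ m
        b<m = ≤-pred (≤-trans (≤-trans (m≤m+n (2 + b) (14 + 7 * b + 8 * r * (2 + b))) (≤-reflexive (arith b r))) 8kR≤)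
          where
          arith : ∀ b r → 2 + b + (14 + 7 * b + 8 * r * (2 + b)) ≡ 8 * ((2 + b) * suc r)
          arith = solve-∀
        A≤ : s * k + suc b ≤ N
        A≤ = ≤-trans (m≤m+n _ r) (≤-reflexive (sym N≡))
        N≤ : N + k * suc b ≤ k * m + Δ
        N≤ = begin
          N + k * suc b
            ≤⟨ +-mono-≤ (≤-trans (≤-reflexive N≡′) (m∸n≤m _ 1)) (*-monoʳ-≤ k (n≤1+n (suc b))) ⟩
          k * m + k * (j + 2) + r + k * k           ≡⟨ arith (k * m) (k * (j + 2)) r (k * k) ⟩
          k * m + Δ                                 ∎
          where
          arith : ∀ a b c d → a + b + c + d ≡ a + (b + c + d)
          arith = solve-∀

-- Indicator functions and lists as sets of vertices.

_∈?_ : ∀ (p : Subset n) xs → Dec (p ∈ xs)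
p ∈? xs = any? (≡-dec Bool._≟_ p) xs

χ : ∀ {P : Set} → Dec P → ℕ
χ d = if does d then 1 else 0

χ>0 : ∀ {P : Set} (d : Dec P) → 0 < χ d → P
χ>0 (yes p) _ = p

χ≡1 : ∀ {P : Set} (d : Dec P) → P → χ d ≡ 1
χ≡1 (yes _) _ = refl
χ≡1 (no ¬p) p = contradiction p ¬p

χ≡0 : ∀ {P : Set} (d : Dec P) → ¬ P → χ d ≡ 0
χ≡0 (yes p) ¬p = contradiction p ¬p
χ≡0 (no _)  _  = refl

∈-ins⁻ : ∀ (v i : Fin n) p → i Subset.∈ ins v p → i ≡ v ⊎ i Subset.∈ p
∈-ins⁻ zero    zero    (x ∷ p) _         = inj₁ refl
∈-ins⁻ zero    (suc i) (x ∷ p) (there q) = inj₂ (there q)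
∈-ins⁻ (suc v) zero    (x ∷ p) here      = inj₂ here
∈-ins⁻ (suc v) (suc i) (x ∷ p) (there q) with ∈-ins⁻ v i p q
... | inj₁ refl = inj₁ refl
... | inj₂ r    = inj₂ (there r)

∈-ins⁺ : ∀ (v i : Fin n) p → i Subset.∈ p → i Subset.∈ ins v p
∈-ins⁺ v i p i∈p with i Fin.≟ v
... | yes refl = []≔-updates p v
... | no i≢v   = []≔-minimal p i v i≢v i∈p

∈-fromList⁻ : ∀ {i : Fin n} A → i Subset.∈ fromList A → i ∈ A
∈-fromList⁻ []      q = contradiction q ∉⊥
∈-fromList⁻ (v ∷ A) q with ∈-ins⁻ v _ (fromList A) q
... | inj₁ eq = here eq
... | inj₂ r  = there (∈-fromList⁻ A r)

∈-fromList⁺ : ∀ {i : Fin n} A → i ∈ A → i Subset.∈ fromList A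
∈-fromList⁺ (v ∷ A) (here refl) = []≔-updates (fromList A) v
∈-fromList⁺ (v ∷ A) (there q)   = ∈-ins⁺ v _ (fromList A) (∈-fromList⁺ A q)

∣ins∣≤ : ∀ (v : Fin n) p → ∣ ins v p ∣ ≤ suc ∣ p ∣
∣ins∣≤ zero    (true  ∷ p) = n≤1+n _
∣ins∣≤ zero    (false ∷ p) = ≤-refl
∣ins∣≤ (suc v) (true  ∷ p) = s≤s (∣ins∣≤ v p)
∣ins∣≤ (suc v) (false ∷ p) = ∣ins∣≤ v p

∣ins∣-∉ : ∀ (v : Fin n) p → ¬ v Subset.∈ p → ∣ ins v p ∣ ≡ suc ∣ p ∣
∣ins∣-∉ zero    (true  ∷ p) v∉p = contradiction here v∉p
∣ins∣-∉ zero    (false ∷ p) v∉p = refl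
∣ins∣-∉ (suc v) (true  ∷ p) v∉p = cong suc (∣ins∣-∉ v p (v∉p ∘ there))
∣ins∣-∉ (suc v) (false ∷ p) v∉p = ∣ins∣-∉ v p (v∉p ∘ there)

∣fromList∣≤ : ∀ (A : List (Fin n)) → ∣ fromList A ∣ ≤ length A
∣fromList∣≤ {n} []  = ≤-reflexive (∣⊥∣≡0 n)
∣fromList∣≤ (v ∷ A) = ≤-trans (∣ins∣≤ v (fromList A)) (s≤s (∣fromList∣≤ A))

∣fromList∣ : ∀ {A : List (Fin n)} → Unique A → ∣ fromList A ∣ ≡ length A
∣fromList∣ {n} []           = ∣⊥∣≡0 n
∣fromList∣ {A = v ∷ A} (v∉ ∷ u) = ≡.trans
  (∣ins∣-∉ v (fromList A) (λ q → All.lookup v∉ (∈-fromList⁻ A q) refl))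
  (cong suc (∣fromList∣ u))

S-fromList : ∀ A L (h : Subset n → ℕ) → h (fromList A) ≤ S (length A) (A ++ L) h
S-fromList []      L h = ≤-refl
S-fromList (v ∷ A) L h = ≤-trans (S-fromList A L (h ∘ ins v)) (m≤n+m _ _)

-- The elements of p, filtered out of `allFin n`, form a repetition-free list that represents p, so
-- `h p` is one of the terms of the sum.
S-positive : ∀ (p : Subset n) {h : Subset n → ℕ} → h p ≤ S ∣ p ∣ (allFin n) h
S-positive {n} p {h} = begin
  h p                                     ≡⟨ cong h fromList-E ⟨
  h (fromList E)                          ≤⟨ S-fromList E _ h ⟩
  S (length E) (E ++ filter (¬? ∘ P?) (allFin n)) h ≡⟨ S-↭ (length E) h (filter-split P? (allFin n)) ⟩
  S (length E) (allFin n) h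
    ≡⟨ cong (λ j → S j (allFin n) h) (≡.trans (sym (∣fromList∣ unique-E)) (cong ∣_∣ fromList-E)) ⟩
  S ∣ p ∣ (allFin n) h                    ∎
  where
  open ≤-Reasoning
  P? : ∀ i → Dec (i Subset.∈ p)
  P? i = i Subset.∈? p
  E = filter P? (allFin n)
  unique-E : Unique E
  unique-E = Unique.filter⁺ P? (Unique.allFin⁺ n)
  fromList-E : fromList E ≡ p
  fromList-E = ⊆-antisym (λ q → proj₂ (∈-filter⁻ P? {xs = allFin n} (∈-fromList⁻ E q)))
                         (λ q → ∈-fromList⁺ E (∈-filter⁺ P? (∈-allFin _) q))

length-≤-S : ∀ {k} {xs : List (Subset n)} → Unique xs → All (λ p → ∣ p ∣ ≡ k) xs →
             length xs ≤ S k (allFin n) (λ p → χ (p ∈? xs))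
length-≤-S []      _ = z≤n
length-≤-S {n} {xs = x ∷ xs} (x∉ ∷ u) (refl ∷ ks) = begin
  1 + length xs
    ≤⟨ +-mono-≤ (≤-trans (≤-reflexive (sym (χ≡1 (≡-dec Bool._≟_ x x) refl))) (S-positive x {λ p → χ (≡-dec Bool._≟_ p x)})) (length-≤-S u ks) ⟩
  S j (allFin n) (λ p → χ (≡-dec Bool._≟_ p x)) + S j (allFin n) (λ p → χ (p ∈? xs))
    ≡⟨ S-+ j (allFin n) (λ p → χ (≡-dec Bool._≟_ p x)) (λ p → χ (p ∈? xs)) ⟨
  S j (allFin n) (λ p → χ (≡-dec Bool._≟_ p x) + χ (p ∈? xs))
    ≤⟨ S-mono j (allFin n) split ⟩
  S j (allFin n) (λ p → χ (p ∈? (x ∷ xs))) ∎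
  where
  open ≤-Reasoning
  j = ∣ x ∣
  split : ∀ p → χ (≡-dec Bool._≟_ p x) + χ (p ∈? xs) ≤ χ (p ∈? (x ∷ xs))
  split p with ≡-dec Bool._≟_ p x
  ... | no  _    = ≤-refl
  ... | yes refl = ≤-reflexive (cong suc (χ≡0 (p ∈? xs) (λ q → All.lookup x∉ q refl)))

-- Matchings and the matching number.

filter-∈-sublists : ∀ {P : A → Set} (P? : ∀ x → Dec (P x)) xs → filter P? xs ∈ sublists xs
filter-∈-sublists P? []       = here refl
filter-∈-sublists P? (x ∷ xs) with P? x
... | yes _ = ∈-++⁺ʳ (sublists xs) (∈-map⁺ (x ∷_) (filter-∈-sublists P? xs))
... | no  _ = ∈-++⁺ˡ (filter-∈-sublists P? xs)

Unique-⊆-length : ∀ {xs ys : List A} → Unique xs → (∀ {x} → x ∈ xs → x ∈ ys) → length xs ≤ length ys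
Unique-⊆-length []       _     = z≤n
Unique-⊆-length {xs = x ∷ xs} {ys} (x∉ ∷ u) xs⊆ys with _ , zs , ys↭ , refl ← Any⇒↭ (xs⊆ys (here refl)) =
  ≤-trans (s≤s (Unique-⊆-length u λ q → remove q (∈-resp-↭ ys↭ (xs⊆ys (there q)))))
          (≤-reflexive (sym (↭-length ys↭)))
  where
  remove : ∀ {y zs} → y ∈ xs → y ∈ x ∷ zs → y ∈ zs
  remove q (here refl) = contradiction refl (All.lookup x∉ q)
  remove q (there r)   = r

AllPairs-lookup : ∀ {R : A → A → Set} {xs} → (∀ {x y} → R x y → R y x) → AllPairs R xs →
                  ∀ {x y} → x ∈ xs → y ∈ xs → x ≢ y → R x y
AllPairs-lookup R-sym (_ ∷ _)  (here refl) (here refl) x≢y = contradiction refl x≢y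
AllPairs-lookup R-sym (r ∷ _)  (here refl) (there y∈)  _   = All.lookup r y∈
AllPairs-lookup R-sym (r ∷ _)  (there x∈)  (here refl) _   = R-sym (All.lookup r x∈)
AllPairs-lookup R-sym (_ ∷ rs) (there x∈)  (there y∈)  x≢y = AllPairs-lookup R-sym rs x∈ y∈ x≢y

Unique⇒AllPairs : ∀ {R : A → A → Set} {xs} → Unique xs → (∀ {x y} → x ∈ xs → y ∈ xs → x ≢ y → R x y) → AllPairs R xs
Unique⇒AllPairs []       _ = []
Unique⇒AllPairs (x∉ ∷ u) r =
  All.tabulate (λ y∈ → r (here refl) (there y∈) (All.lookup x∉ y∈)) ∷
  Unique⇒AllPairs u (λ x∈ y∈ → r (there x∈) (there y∈))

Disjoint-sym : ∀ {p q : Subset n} → Disjoint p q → Disjoint q p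
Disjoint-sym {p = p} {q} d (i , i∈) with i∈q , i∈p ← x∈p∩q⁻ q p i∈ = d (i , x∈p∩q⁺ (i∈p , i∈q))

-- The maximum in `ν` runs over sublists of `members F`, whereas M may list its sets in another
-- order. Filtering `members F` by membership in M gives a sublist that is still a matching and at
-- least as long.
matching-≤-ν : ∀ (F : Family n) {M} → AllPairs Disjoint M → Unique M → (∀ {p} → p ∈ M → p ∈ members F) → length M ≤ ν F
matching-≤-ν F {M} disj u M⊆F = ≤-trans
  (Unique-⊆-length u (λ p∈ → ∈-filter⁺ (_∈? M) (M⊆F p∈) p∈))
  (v≤max⁺ 0 (map length (filter (allPairs? disjoint?) (sublists (members F))))
    (inj₂ (Any.map ≤-reflexive (∈-map⁺ length (∈-filter⁺ (allPairs? disjoint?) (filter-∈-sublists (_∈? M) (members F)) X-disj)))))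
  where
  X = filter (_∈? M) (members F)
  X-disj : AllPairs Disjoint X
  X-disj = Unique⇒AllPairs (Unique.filter⁺ (_∈? M) (unique F))
    (λ x∈ y∈ → AllPairs-lookup Disjoint-sym disj (proj₂ (∈-filter⁻ (_∈? M) {xs = members F} x∈)) (proj₂ (∈-filter⁻ (_∈? M) {xs = members F} y∈)))

Unique-++⁻ˡ : ∀ xs {ys : List A} → Unique (xs ++ ys) → Unique xs
Unique-++⁻ˡ []       _        = []
Unique-++⁻ˡ (x ∷ xs) (x∉ ∷ u) = All.++⁻ˡ xs x∉ ∷ Unique-++⁻ˡ xs u

Unique-++⁻ʳ : ∀ xs {ys : List A} → Unique (xs ++ ys) → Unique ys
Unique-++⁻ʳ []       u       = u
Unique-++⁻ʳ (x ∷ xs) (_ ∷ u) = Unique-++⁻ʳ xs u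

Unique-++-disjoint : ∀ xs {ys : List A} → Unique (xs ++ ys) → ∀ {x} → x ∈ xs → x ∉ ys
Unique-++-disjoint (x ∷ xs) (x∉ ∷ u) (here refl) q = All.lookup x∉ (∈-++⁺ʳ xs q) refl
Unique-++-disjoint (x ∷ xs) (x∉ ∷ u) (there p)   q = Unique-++-disjoint xs u p q

Unique-concat⁻ : ∀ {xss : List (List A)} → Unique (concat xss) → All Unique xss
Unique-concat⁻ {xss = []}      _ = []
Unique-concat⁻ {xss = xs ∷ xss} u = Unique-++⁻ˡ xs u ∷ Unique-concat⁻ (Unique-++⁻ʳ xs u)

fromList-disjoint : ∀ (M : List (List (Fin n))) → Unique (concat M) → AllPairs Disjoint (map fromList M)
fromList-disjoint []      u = []
fromList-disjoint (E ∷ M) u =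
  All.map⁺ (All.tabulate λ {B} B∈ (i , i∈) → let i∈E , i∈B = x∈p∩q⁻ (fromList E) (fromList B) i∈ in
    Unique-++-disjoint E u (∈-fromList⁻ E i∈E) (∈-concat⁺′ (∈-fromList⁻ B i∈B) B∈))
  ∷ fromList-disjoint M (Unique-++⁻ʳ E u)

-- Two disjoint sets can coincide only if they are empty, which the positive lengths exclude.
fromList-unique : ∀ {M : List (List (Fin n))} → All (λ B → 0 < length B) M → AllPairs Disjoint (map fromList M) →
                  Unique (map fromList M)
fromList-unique {M = []}    _         _        = []
fromList-unique {M = (v ∷ E) ∷ M} (_ ∷ ps) (d ∷ ds) =
  All.map (λ dis eq → dis (v , x∈p∩q⁺ ([]≔-updates (fromList E) v , subst (v Subset.∈_) eq ([]≔-updates (fromList E) v)))) d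
  ∷ fromList-unique ps ds

-- Cardinalities of `binom` and `initial`.

length-filter-map : ∀ {P : B → Set} {Q : A → Set} (P? : ∀ y → Dec (P y)) (Q? : ∀ x → Dec (Q x)) (f : A → B) →
                    (∀ x → P (f x) → Q x) → (∀ x → Q x → P (f x)) →
                    ∀ xs → length (filter P? (map f xs)) ≡ length (filter Q? xs)
length-filter-map P? Q? f to from []       = refl
length-filter-map P? Q? f to from (x ∷ xs) with P? (f x) | Q? x
... | yes _  | yes _ = cong suc (length-filter-map P? Q? f to from xs)
... | no  _  | no  _ = length-filter-map P? Q? f to from xs
... | yes h  | no ¬q = contradiction (to x h) ¬q
... | no ¬h  | yes q = contradiction (from x q) ¬h

-- `subsets` splits by whether the first element is chosen, which is Pascal's rule if that element
-- lies in X; otherwise the second half contributes nothing.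
card-binom : ∀ (X : Subset n) k → card (binom X k) ≡ ∣ X ∣ C k
card-binom = count
  where
  P? : ∀ {n} (X : Subset n) k p → Dec (p Subset.⊆ X × ∣ p ∣ ≡ k)
  P? X k p = (p ⊆? X) ×-dec (∣ p ∣ ≟ k)

  count-none : ∀ {n} (X : Subset (suc n)) k b (ps : List (Subset n)) →
               (∀ p → ¬ (b ∷ p Subset.⊆ X × ∣ b ∷ p ∣ ≡ k)) → length (filter (P? X k) (map (b ∷_) ps)) ≡ 0
  count-none X k b ps none = cong length (filter-none (P? X k) (All.map⁺ (All.universal none ps)))

  count : ∀ {n} (X : Subset n) k → length (filter (P? X k) (subsets n)) ≡ ∣ X ∣ C k
  count-split : ∀ {n} (X : Subset (suc n)) k → length (filter (P? X k) (subsets (suc n))) ≡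
    length (filter (P? X k) (map (outside ∷_) (subsets n))) + length (filter (P? X k) (map (inside ∷_) (subsets n)))
  count-split {n} X k = ≡.trans (cong length (filter-++ (P? X k) (map (outside ∷_) (subsets n)) _))
                                (length-++ (filter (P? X k) (map (outside ∷_) (subsets n))))
  count-outside : ∀ {n} x (X : Subset n) k → length (filter (P? (x ∷ X) k) (map (outside ∷_) (subsets n))) ≡ ∣ X ∣ C k
  count-outside x X k = ≡.trans (length-filter-map (P? (x ∷ X) k) (P? X k) (outside ∷_)
    (λ p (s , l) → drop-∷-⊆ s , l) (λ p (s , l) → out⊆ s , l) (subsets _)) (count X k)

  count []          zero    = refl
  count []          (suc k) = refl
  count (false ∷ X) k       = ≡.trans (count-split (false ∷ X) k) (≡.trans
    (cong₂ _+_ (count-outside false X k) (count-none (false ∷ X) k inside (subsets _) λ p (s , _) → contradiction (s here) λ ()))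
    (+-identityʳ _))
  count (true ∷ X)  zero    = ≡.trans (count-split (true ∷ X) 0)
    (cong₂ _+_ (count-outside true X 0) (count-none (true ∷ X) 0 inside (subsets _) λ p ()))
  count (true ∷ X)  (suc k) = ≡.trans (count-split (true ∷ X) (suc k)) (≡.trans
    (cong₂ _+_ (count-outside true X (suc k)) (≡.trans (length-filter-map (P? (true ∷ X) (suc k)) (P? X k) (inside ∷_)
      (λ p (s , l) → drop-∷-⊆ s , suc-injective l) (λ p (s , l) → in⊆in s , cong suc l) (subsets _)) (count X k)))
    (≡.trans (+-comm (∣ X ∣ C suc k) _) (sym (pascal ∣ X ∣ k))))

∣initial∣ : ∀ {n m} → m ≤ n → ∣ initial n m ∣ ≡ m
∣initial∣ {zero}  {zero}  _         = refl
∣initial∣ {suc n} {zero}  _         = ∣initial∣ {n} {zero} z≤n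
∣initial∣ {suc n} {suc m} (s≤s m≤n) = cong suc (∣initial∣ m≤n)

-- From a large family to s + 1 disjoint members.

Unique-resp-↭ : ∀ {xs ys : List A} → xs ↭ ys → Unique xs → Unique ys
Unique-resp-↭ p = Permutation.Unique-resp-↭ (≡.setoid _) (↭⇒↭ₛ p)

χ≤1 : ∀ {P : Set} (d : Dec P) → χ d ≤ 1
χ≤1 (yes _) = ≤-refl
χ≤1 (no _)  = z≤n

chunk : ∀ k c (xs : List A) → length xs ≡ c * k →
        ∃ λ P → length P ≡ c × All (λ e → length e ≡ k) P × concat P ≡ xs
chunk k zero    []       _ = [] , refl , [] , refl
chunk k (suc c) xs       l =
  let P , lP , ls , eq = chunk k c (drop k xs) (≡.trans (length-drop k xs) (≡.trans (cong (_∸ k) l) (m+n∸m≡n k (c * k))))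
  in take k xs ∷ P , cong suc lP ,
     ≡.trans (length-take k xs) (m≤n⇒m⊓n≡m (≤-trans (m≤m+n k (c * k)) (≤-reflexive (sym l)))) ∷ ls ,
     ≡.trans (cong (_++_ (take k xs)) eq) (take++drop≡id k xs)

module _ (b r s N : ℕ) (key : 16 * (2 + b) * r + 20 * ((2 + b) * (2 + b)) ≤ s)
         (N-def : suc N ≡ (s + 1) * (2 + b) + r)
         (F : Family (suc N)) (F⊆ : F ⊆ᶠ binom ⊤ (2 + b)) where

  private
    k R N₀ : ℕ
    k = 2 + b
    R = suc r
    N₀ = (s + 1) * k ∸ 1

    V : List (Fin (suc N))
    V = allFin (suc N)

    f g : Subset (suc N) → ℕ
    f p = χ (p ∈? members F)
    -- The size condition makes `g` vanish on smaller sets, as `g-van` demands.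
    g p = χ (¬? (p ∈? members F) ×-dec (∣ p ∣ ≟ k))

    ∣p∣≡k : ∀ {p} → p ∈ members F → ∣ p ∣ ≡ k
    ∣p∣≡k p∈ = proj₂ (proj₂ (∈-filter⁻ (λ p → (p ⊆? ⊤) ×-dec (∣ p ∣ ≟ k)) {xs = subsets (suc N)} (F⊆ p∈)))

    short : ∀ (A : List (Fin (suc N))) → length A < k → ∣ fromList A ∣ ≢ k
    short A l eq = <⇒≢ (≤-trans (s≤s (∣fromList∣≤ A)) l) eq

    f-van : VanishesBelow k f
    f-van A l = χ≡0 (fromList A ∈? members F) (short A l ∘ ∣p∣≡k)

    g-van : VanishesBelow k g
    g-van A l = χ≡0 (¬? (fromList A ∈? members F) ×-dec (∣ fromList A ∣ ≟ k)) (short A l ∘ proj₂)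

    f+g≤1 : ∀ p → f p + g p ≤ 1
    f+g≤1 p with p ∈? members F
    ... | yes _ = ≤-refl
    ... | no  _ = χ≤1 (∣ p ∣ ≟ k)

    open Numbers b r s N key N-def
    open Cover b N V (length-tabulate id) ∈-allFin f g f+g≤1 f-van g-van
      using (c; #heavy; heavy; light; Heavy; heavy?; Edge; gdeg; g≤1; few-heavy; length-concat; module Greedy)
    open Repartition (suc b) g g≤1 V using (Good; repartition)

    N₀+R : N₀ + R ≡ suc N
    N₀+R = ≡.trans (+-suc N₀ r) (≡.trans (cong (_+ r) (m+[n∸m]≡n {1} {(s + 1) * k} (*-mono-≤ (m≤n+m 1 s) (s≤s z≤n)))) (sym N-def))

    ∈F-edge : ∀ B → Edge B → fromList B ∈ members F
    ∈F-edge B (_ , 0<f) = χ>0 (fromList B ∈? members F) 0<f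

    ∈F-good : ∀ B → Unique B → Good B → fromList B ∈ members F
    ∈F-good B u (lB , gB) = decidable-stable (fromList B ∈? members F) λ ∉F →
      0≢1+n (≡.trans (sym gB) (χ≡1 (¬? (fromList B ∈? members F) ×-dec (∣ fromList B ∣ ≟ k)) (∉F , ≡.trans (∣fromList∣ u) lB)))

    module _ (large : N₀ C k < card F) where

      <Sf : N₀ C k < S k V f
      <Sf = ≤-trans large (length-≤-S (unique F) (All.tabulate ∣p∣≡k))

      -- Going from N₀ to n = N₀ + R vertices raises the number of k-sets by at most R c, and `f`
      -- accounts for more than `N₀ C k` of them.
      Sg< : S k V g < R * c
      Sg< = +-cancelˡ-< (N₀ C k) _ _ (begin-strict
        N₀ C k + S k V g          <⟨ +-monoˡ-< (S k V g) <Sf ⟩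
        S k V f + S k V g         ≡⟨ S-+ k V f g ⟨
        S k V (λ p → f p + g p)   ≤⟨ S-≤-C k V f+g≤1 ⟩
        length V C k
          ≡⟨ cong (_C k) (≡.trans (length-tabulate {n = suc N} id) (≡.trans (sym N₀+R) (+-comm N₀ R))) ⟩
        (R + N₀) C k              ≤⟨ C-telescope-≤ R (suc b) (≤-reflexive (≡.trans (+-comm R N₀) N₀+R)) ⟩
        N₀ C k + R * c            ∎)
        where open ≤-Reasoning

      q≤ : #heavy V ≤ 3 * r + 2
      q≤ = ≤-pred (≤-trans (few-heavy R Sg< 18R≤) (≤-reflexive (arith r)))
        where
        arith : ∀ r → 3 * suc r ≡ suc (3 * r + 2)
        arith = solve-∀

      cover′ : ∃₂ λ M L → concat M ++ L ↭ V × All Edge M × length M ≤ #heavy V × #heavy L < R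
      cover′ with R ≤? #heavy V
      -- With at most r heavy vertices, discarding takes care of all of them and the cover can be
      -- empty.
      ... | no R≰q  = [] , V , ↭-refl , [] , z≤n , ≰⇒> R≰q
      ... | yes R≤q = Greedy.cover (#heavy V ∸ R) R N₀ (m∸n+n≡m R≤q) N₀+R (s≤s z≤n) <Sf (2q≤ q≤)

      -- Membership in F is conditional on `Unique B`: `g` is also 0 on sets of the wrong size, so a
      -- good block is known to be a member only once it has no repetitions. `s<ν` obtains this from
      -- the permutation of `V`.
      matching : ∃₂ λ M Z → concat M ++ Z ↭ V × All (λ B → length B ≡ k × (Unique B → fromList B ∈ members F)) M ×
                 length M ≡ suc s
      matching =
        let M , L , ML↭V , edges , M≤q , #L<R = cover′
            j = length M
            j≤ : j ≤ 3 * r + 2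
            j≤ = ≤-trans M≤q q≤
            m = s ∸ suc j
            m+j : suc m + j ≡ s
            m+j = ≡.trans (sym (+-suc m j)) (m∸n+n≡m (j<s j≤))
            -- The heavy vertices come first and number at most r, so `drop r` discards all of them.
            Y = heavy L ++ light L
            Y↭L = filter-split heavy? L
            lY : length Y ≡ r + suc (suc m) * k
            lY = +-cancelˡ-≡ (j * k) _ _ (≡.trans (cong₂ _+_ (sym (length-concat edges)) (↭-length Y↭L))
                   (≡.trans (sym (length-++ (concat M))) (≡.trans (↭-length ML↭V) (≡.trans (length-tabulate {n = suc N} id)
                   (≡.trans N-def (≡.trans (cong (λ t → (t + 1) * k + r) (sym m+j)) (arith m j k r)))))))
            P , lP , blocks , P≡ = chunk k (suc (suc m)) (drop r Y)
              (≡.trans (length-drop r Y) (≡.trans (cong (_∸ r) lY) (m+n∸m≡n r (suc (suc m) * k))))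
            P-light : All (¬_ ∘ Heavy) (concat P)
            P-light = subst (All (¬_ ∘ Heavy)) (sym P≡)
              (All-drop-++ r (heavy L) (≤-pred #L<R) (All.all-filter (¬? ∘ heavy?) L))
            ZP↭V : (concat M ++ take r Y) ++ concat P ↭ V
            ZP↭V = ↭-trans (↭-reflexive (≡.trans (++-assoc (concat M) (take r Y) (concat P))
              (cong (λ t → concat M ++ (take r Y ++ t)) P≡)))
              (↭-trans (++⁺ˡ (concat M) (↭-trans (take-drop-↭ r Y) Y↭L)) ML↭V)
            P′ , lP′ , goods , P′↭P = repartition c m (many-transversals j≤ m+j) (total (8kR≤ j≤ m+j))
              {concat M ++ take r Y} P lP blocks ZP↭V (All.map ≰⇒> P-light)
        in M ++ P′ , take r Y ,
           ↭-trans (rearrange M P′) (↭-trans (++⁺ˡ (concat M ++ take r Y) P′↭P) ZP↭V) ,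
           All.++⁺ (All.map (λ {B} edge → proj₁ edge , λ _ → ∈F-edge B edge) edges) (All.map (λ {B} good → proj₁ good , λ u → ∈F-good B u good) goods) ,
           ≡.trans (length-++ M) (≡.trans (cong (_+_ j) lP′) (≡.trans (arith′ j m) (cong suc m+j)))
        where
        j<s : ∀ {j} → j ≤ 3 * r + 2 → j < s
        j<s {j} j≤ = ≤-trans (m≤n+m (suc j) (15 + 8 * b + 8 * r * k)) (≤-trans (≤-reflexive (arith b r j)) (8kR+j≤ j≤))
          where
          arith : ∀ b r j → 15 + 8 * b + 8 * r * (2 + b) + suc j ≡ 8 * ((2 + b) * suc r) + j
          arith = solve-∀
        arith : ∀ m j k r → (suc m + j + 1) * k + r ≡ j * k + (r + suc (suc m) * k)
        arith = solve-∀
        arith′ : ∀ j m → j + suc (suc m) ≡ suc (suc m + j)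
        arith′ = solve-∀
        total : ∀ {m} → 8 * (k * suc r) ≤ suc m → 8 * ∑ gdeg V ≤ suc m * c
        total {m} 8kR≤m = begin
          8 * ∑ gdeg V           ≡⟨ cong (_*_ 8) (S-degree-sum (suc b) V g g-van) ⟩
          8 * (k * S k V g)      ≤⟨ *-monoʳ-≤ 8 (*-monoʳ-≤ k (<⇒≤ Sg<)) ⟩
          8 * (k * (R * c))      ≡⟨ arith″ k R c ⟩
          8 * (k * R) * c        ≤⟨ *-monoˡ-≤ c 8kR≤m ⟩
          suc m * c              ∎
          where
          open ≤-Reasoning
          arith″ : ∀ k R c → 8 * (k * (R * c)) ≡ 8 * (k * R) * c
          arith″ = solve-∀
        rearrange : ∀ M P {Z : List (Fin (suc N))} → concat (M ++ P) ++ Z ↭ (concat M ++ Z) ++ concat P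
        rearrange M P {Z} = ↭-trans (++⁺ʳ Z (↭-reflexive (sym (concat-++ M P))))
          (↭-trans (↭-reflexive (++-assoc (concat M) (concat P) Z))
          (↭-trans (++⁺ˡ (concat M) (++-comm (concat P) Z)) (↭-reflexive (sym (++-assoc (concat M) Z (concat P))))))

      s<ν : s < ν F
      s<ν =
        let M , Z , MZ↭V , blocks , lM = matching
            u = Unique-++⁻ˡ (concat M) (Unique-resp-↭ (↭-sym MZ↭V) (Unique.allFin⁺ (suc N)))
            disj = fromList-disjoint M u
            in-F = All.map⁺ (All.zipWith (λ { ((_ , ∈F) , uB) → ∈F uB }) (blocks , Unique-concat⁻ u))
        in ≤-trans (≤-reflexive (≡.trans (sym lM) (sym (length-map fromList M))))
             (matching-≤-ν F disj (fromList-unique (All.map (λ (lB , _) → subst (0 <_) (sym lB) (s≤s z≤n)) blocks) disj)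
               (All.lookup in-F))

  card-≤ : ν F ≤ s → card F ≤ ((s + 1) * (2 + b) ∸ 1) C (2 + b)
  card-≤ ν≤s = ≮⇒≥ λ large → <⇒≱ (s<ν large) ν≤s

-- The hypotheses of the theorem in integer form, and the conclusion.

key-inequality : ∀ {s k r} → k ≥ 5 → s > 101 * k ^ 3 → 100 * k * r ≤ s → 16 * k * r + 20 * (k * k) ≤ s
key-inequality {s} {k} {r} k≥5 s> 100kr≤s = *-cancelˡ-≤ 2 (begin
  2 * (16 * k * r + 20 * (k * k))      ≡⟨ arith₁ k r ⟩
  32 * (k * r) + 40 * (k * k)
    -- The inequality is doubled so that s can be used once against 100 k r and once against 101 k³;
    -- k ≥ 5 gives 101 k ≥ 505 = 40 + 465.
    ≤⟨ +-mono-≤ (*-monoˡ-≤ (k * r) (m≤m+n 32 68)) (*-monoˡ-≤ (k * k) (≤-trans (m≤m+n 40 465) (*-monoʳ-≤ 101 k≥5))) ⟩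
  100 * (k * r) + 101 * k * (k * k)    ≡⟨ arith₂ k r ⟩
  100 * k * r + 101 * (k * (k * (k * 1))) ≤⟨ +-mono-≤ 100kr≤s (<⇒≤ s>) ⟩
  s + s                                ≡⟨ cong (_+_ s) (+-identityʳ s) ⟨
  2 * s                                ∎)
  where
  open ≤-Reasoning
  arith₁ : ∀ k r → 2 * (16 * k * r + 20 * (k * k)) ≡ 32 * (k * r) + 40 * (k * k)
  arith₁ = solve-∀
  arith₂ : ∀ k r → 100 * (k * r) + 101 * k * (k * k) ≡ 100 * k * r + 101 * (k * (k * (k * 1)))
  arith₂ = solve-∀

-- The order on unnormalised rationals is an inequality of cross-multiplied integers. Writing k as 2
-- + b lets the denominator 100 k reduce to a successor.
clear-denominators : ∀ n t b → let k = 2 + b in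
  (+ n / 1) ℚ.< (+ t / 1) ℚ.* ((+ k / 1) ℚ.+ (+ 1 / (100 * k)) {{m*n≢0 100 k}}) →
  n * (100 * k) < t * (k * (100 * k) + 1)
clear-denominators n t b n< = drop‿+<+ (subst₂ ℤ._<_ lhs rhs (drop-*<* n<))
  where
  k = 2 + b
  lhs : + n ℤ.* + (1 * (1 * (100 * k))) ≡ + (n * (100 * k))
  lhs = ≡.trans (sym (pos-* n _)) (cong (λ x → + (n * x)) (≡.trans (*-identityˡ _) (*-identityˡ _)))
  rhs : (+ t ℤ.* (+ k ℤ.* + (100 * k) ℤ.+ + 1 ℤ.* + 1)) ℤ.* + 1 ≡ + (t * (k * (100 * k) + 1))
  rhs = ≡.trans (ℤ.*-identityʳ _) (≡.trans (cong (λ x → + t ℤ.* (x ℤ.+ + 1)) (sym (pos-* k (100 * k)))) (sym (pos-* t _)))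

theorem1p2 : (s k n : ℕ) .{{_ : NonZero s}} .{{k≢0 : NonZero k}} →
    s > k → k ≥ 5 → s > 101 * k ^ 3 →
    (s + 1) * k ≤ n →
    (+ n / 1) ℚ.< (+ (s + 1) / 1) ℚ.* ((+ k / 1) ℚ.+ (+ 1 / (100 * k)) {{m*n≢0 100 k}}) →
    (F : Family n) → F ⊆ᶠ binom ⊤ k → ν F ≤ s →
    (card F ≤ card (binom (initial n ((s + 1) * k ∸ 1)) k)) × (card F ≤ ((s + 1) * k ∸ 1) C k)
theorem1p2 s (suc zero) n _ (s≤s ())
theorem1p2 s k@(suc (suc b)) zero _ _ _ sk≤0 = contradiction (≤-trans (*-mono-≤ (m≤n+m 1 s) (s≤s z≤n)) sk≤0) λ ()
theorem1p2 s k@(suc (suc b)) (suc N) s>k k≥5 s> sk≤n n< F F⊆ ν≤s =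
  ≤-trans bound (≤-reflexive (sym (≡.trans (card-binom (initial (suc N) N₀) k) (cong (_C k) (∣initial∣ N₀≤n))))) , bound
  where
  N₀ = (s + 1) * k ∸ 1
  r = suc N ∸ (s + 1) * k
  N₀≤n : N₀ ≤ suc N
  N₀≤n = ≤-trans (m∸n≤m _ 1) sk≤n
  N-def : suc N ≡ (s + 1) * k + r
  N-def = sym (m+[n∸m]≡n sk≤n)
  -- The upper bound on n = (s + 1) k + r says r < (s + 1) / (100 k), that is, 100 k r < s + 1.
  100kr≤s : 100 * k * r ≤ s
  100kr≤s = ≤-pred (≤-trans (+-cancelˡ-< ((s + 1) * k * (100 * k)) _ _ (begin-strict
    (s + 1) * k * (100 * k) + 100 * k * r     ≡⟨ arith₁ ((s + 1) * k) (100 * k) r ⟩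
    ((s + 1) * k + r) * (100 * k)             ≡⟨ cong (_* (100 * k)) N-def ⟨
    suc N * (100 * k)                         <⟨ clear-denominators (suc N) (s + 1) b n< ⟩
    (s + 1) * (k * (100 * k) + 1)             ≡⟨ arith₂ (s + 1) k (100 * k) ⟩
    (s + 1) * k * (100 * k) + (s + 1)         ∎)) (≤-reflexive (+-comm s 1)))
    where
    open ≤-Reasoning
    arith₁ : ∀ a b r → a * b + b * r ≡ (a + r) * b
    arith₁ = solve-∀
    arith₂ : ∀ t k b → t * (k * b + 1) ≡ t * k * b + t
    arith₂ = solve-∀
  bound : card F ≤ N₀ C k
  bound = card-≤ b r s N (key-inequality {s} {k} {r} k≥5 s> 100kr≤s) N-def F F⊆ ν≤s
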